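{- For every fixed integer $r \geq 1$ there is an algorithm that, given as input a sequence $u$ of length $n$ with $r$ distinct letters, computes $\mathrm{fw}(u)$ with worst-case run time $O(n^{r!+2})$, where the implied constant may depend on $r$. In particular, for each fixed $r$, $\mathrm{fw}(u)$ can be computed in time $O(n^{\alpha_r})$ where $\alpha_r$ is a constant depending only on $r$.
   Context: Sequences are finite words over an alphabet of letters. Two sequences are isomorphic if one is obtained from the other by a one-to-one renaming of letters. A sequence $v$ contains a sequence $u$ if some (not necessarily contiguous) subsequence of $v$ is isomorphic to $u$. An $(r,s)$-formation is a concatenation of $s$ permutations of $r$ distinct letters (the same $r$ letters in each permutation). The formation width $\mathrm{fw}(u)$ is the minimum $s$ for which there exists an integer $r'$ such that every $(r',s)$-formation contains $u$. -}

module Defs where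

open import Data.Bool.Base using (if_then_else_)
open import Data.List.Base using (List; []; _∷_; map; concat; length; deduplicate)
open import Data.List.Membership.Propositional using (_∈_)
open import Data.List.Relation.Binary.Permutation.Propositional using (_↭_)
open import Data.List.Relation.Binary.Sublist.Propositional using (_⊆_)
open import Data.List.Relation.Unary.All using (All)
open import Data.List.Relation.Unary.Unique.Propositional using (Unique)
open import Data.Nat.Base using (ℕ; zero; suc; _+_; _*_; _∸_; _^_; _≤_; _≡ᵇ_)
open import Data.Nat.Properties using (_≟_)
open import Data.Product.Base using (_×_; _,_; ∃-syntax)
open import Relation.Binary.PropositionalEquality using (_≡_; _≢_; refl)
open import Relation.Nullary.Negation using (contradiction)

------------------------------------------------------------------------
-- Sequences and formation width

-- Letters are natural numbers, so that the alphabet is infinite: formations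
-- on any number of letters exist.
Sequence : Set
Sequence = List ℕ

distinctLetters : Sequence → ℕ
distinctLetters u = length (deduplicate _≟_ u)

-- The renaming only has to be one-to-one on the letters that occur.
_≅_ : Sequence → Sequence → Set
u ≅ v = ∃[ f ] (∀ {x y} → x ∈ u → y ∈ u → f x ≡ f y → x ≡ y) × map f u ≡ v

_Contains_ : Sequence → Sequence → Set
v Contains u = ∃[ w ] w ⊆ v × u ≅ w

IsFormation : ℕ → ℕ → Sequence → Set
IsFormation r s w =
  ∃[ letters ] ∃[ perms ]
    Unique letters × length letters ≡ r ×
    length perms ≡ s × All (_↭ letters) perms ×
    w ≡ concat perms

Forces : ℕ → Sequence → Set
Forces s u = ∃[ r′ ] (∀ w → IsFormation r′ s w → w Contains u)

IsFormationWidth : Sequence → ℕ → Set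
IsFormationWidth u s = Forces s u × (∀ s′ → Forces s′ u → s ≤ s′)

------------------------------------------------------------------------
-- Unit-cost random access machine
--
-- Programs are structured (while programs) over registers, which are named
-- by constants in the program text, and a memory addressed by computed
-- values.  Every constant, register or memory access, addition, truncated
-- subtraction, assignment and test for zero costs one step; multiplication
-- is not primitive.

infixl 6 _⊕_ _⊖_
infix  4 _≔_ mem[_]≔_
infixr 3 _⨾_

data Exp : Set where
  lit     : ℕ → Exp
  reg     : ℕ → Exp
  mem[_]  : Exp → Exp
  _⊕_ _⊖_ : Exp → Exp → Exp

data Program : Set where
  skip     : Program
  _≔_      : ℕ → Exp → Program
  mem[_]≔_ : Exp → Exp → Program
  _⨾_      : Program → Program → Program
  ifNZ     : Exp → Program → Program → Program
  whileNZ  : Exp → Program → Program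

record State : Set where
  constructor ⟪_,_⟫
  field
    regs : ℕ → ℕ
    mem  : ℕ → ℕ
open State public

_[_↦_] : (ℕ → ℕ) → ℕ → ℕ → (ℕ → ℕ)
(f [ i ↦ a ]) j = if j ≡ᵇ i then a else f j

⟦_⟧ : Exp → State → ℕ
⟦ lit k ⟧    σ = k
⟦ reg x ⟧    σ = regs σ x
⟦ mem[ e ] ⟧ σ = mem σ (⟦ e ⟧ σ)
⟦ e ⊕ e′ ⟧   σ = ⟦ e ⟧ σ + ⟦ e′ ⟧ σ
⟦ e ⊖ e′ ⟧   σ = ⟦ e ⟧ σ ∸ ⟦ e′ ⟧ σ

cost : Exp → ℕ
cost (lit k)    = 1
cost (reg x)    = 1
cost (mem[ e ]) = suc (cost e)
cost (e ⊕ e′)   = suc (cost e + cost e′)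
cost (e ⊖ e′)   = suc (cost e + cost e′)

-- ⟨ p , σ ⟩⇓[ t ] σ′: started in σ, p halts in σ′ after exactly t steps.
data ⟨_,_⟩⇓[_]_ : Program → State → ℕ → State → Set where
  ⇓skip : ∀ {σ} → ⟨ skip , σ ⟩⇓[ 1 ] σ

  ⇓reg : ∀ {σ x e} →
    ⟨ x ≔ e , σ ⟩⇓[ suc (cost e) ] ⟪ regs σ [ x ↦ ⟦ e ⟧ σ ] , mem σ ⟫

  ⇓mem : ∀ {σ a e} →
    ⟨ mem[ a ]≔ e , σ ⟩⇓[ suc (cost a + cost e) ]
      ⟪ regs σ , mem σ [ ⟦ a ⟧ σ ↦ ⟦ e ⟧ σ ] ⟫

  ⇓seq : ∀ {p q σ σ′ σ″ t t′} →
    ⟨ p , σ ⟩⇓[ t ] σ′ → ⟨ q , σ′ ⟩⇓[ t′ ] σ″ →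
    ⟨ p ⨾ q , σ ⟩⇓[ t + t′ ] σ″

  ⇓if-nz : ∀ {e p q σ σ′ t} → ⟦ e ⟧ σ ≢ 0 → ⟨ p , σ ⟩⇓[ t ] σ′ →
    ⟨ ifNZ e p q , σ ⟩⇓[ suc (cost e + t) ] σ′

  ⇓if-z : ∀ {e p q σ σ′ t} → ⟦ e ⟧ σ ≡ 0 → ⟨ q , σ ⟩⇓[ t ] σ′ →
    ⟨ ifNZ e p q , σ ⟩⇓[ suc (cost e + t) ] σ′

  ⇓while-nz : ∀ {e p σ σ′ σ″ t t′} → ⟦ e ⟧ σ ≢ 0 →
    ⟨ p , σ ⟩⇓[ t ] σ′ → ⟨ whileNZ e p , σ′ ⟩⇓[ t′ ] σ″ →
    ⟨ whileNZ e p , σ ⟩⇓[ suc (cost e + t + t′) ] σ″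

  ⇓while-z : ∀ {e p σ} → ⟦ e ⟧ σ ≡ 0 →
    ⟨ whileNZ e p , σ ⟩⇓[ suc (cost e) ] σ

-- The final state and the running time are functions of program and input.
⇓-deterministic : ∀ {p σ t t′ τ τ′} →
  ⟨ p , σ ⟩⇓[ t ] τ → ⟨ p , σ ⟩⇓[ t′ ] τ′ → t ≡ t′ × τ ≡ τ′
⇓-deterministic ⇓skip ⇓skip = refl , refl
⇓-deterministic ⇓reg ⇓reg = refl , refl
⇓-deterministic ⇓mem ⇓mem = refl , refl
⇓-deterministic (⇓seq a b) (⇓seq a′ b′) with ⇓-deterministic a a′
... | refl , refl with ⇓-deterministic b b′
... | refl , refl = refl , refl
⇓-deterministic (⇓if-nz _ a) (⇓if-nz _ a′) with ⇓-deterministic a a′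
... | refl , refl = refl , refl
⇓-deterministic (⇓if-nz n _) (⇓if-z z _) = contradiction z n
⇓-deterministic (⇓if-z z _) (⇓if-nz n _) = contradiction z n
⇓-deterministic (⇓if-z _ a) (⇓if-z _ a′) with ⇓-deterministic a a′
... | refl , refl = refl , refl
⇓-deterministic (⇓while-nz _ a b) (⇓while-nz _ a′ b′) with ⇓-deterministic a a′
... | refl , refl with ⇓-deterministic b b′
... | refl , refl = refl , refl
⇓-deterministic (⇓while-nz n _ _) (⇓while-z z) = contradiction z n
⇓-deterministic (⇓while-z z) (⇓while-nz n _ _) = contradiction z n
⇓-deterministic (⇓while-z _) (⇓while-z _) = refl , refl

-- Cells beyond the end of the list hold 0.
cells : List ℕ → ℕ → ℕ
cells []       i       = 0
cells (x ∷ xs) zero    = x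
cells (x ∷ xs) (suc i) = cells xs i

-- The sequence occupies the memory from address 0 on and its length is in
-- register 0; everything else is 0.
input : Sequence → State
input u = ⟪ (λ _ → 0) [ 0 ↦ length u ] , cells u ⟫

output : State → ℕ
output σ = regs σ 0

-- On sequences u of length n with exactly r distinct letters, fw(u) is
-- computed by one program in worst-case time O(n ^ k).  For r ≥ 1 every such
-- n is positive, so the O-bound can be required of all inputs.
FwComputableInTime : ℕ → ℕ → Set
FwComputableInTime r k =
  ∃[ p ] ∃[ C ] (∀ u → distinctLetters u ≡ r →
    ∃[ t ] ∃[ σ ] ⟨ p , input u ⟩⇓[ t ] σ
                × IsFormationWidth u (output σ)
                × t ≤ C * length u ^ k)

{-# OPTIONS --safe #-}
module Submission where

-- Call a formation binary if every block is a fixed word xs or its reversal; a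
-- pattern f of Booleans records which, and binary xs f is the formation.  For u
-- with the r distinct letters ds, "Forces s u" holds exactly when, for every
-- pattern f of length s, some arrangement π of ds has u as a subsequence of
-- binary π f.  One direction (forces⇒binary) deletes, from a binary formation on
-- many letters, the letters that the copy of u does not use.  The other
-- (binary⇒forces) is Ramsey theory: any s permutations of sufficiently many
-- letters agree, up to reversal, on some r of the letters.
--
-- Whether u is a subsequence of binary π f is decided by greedy matching, which
-- remembers only how long a prefix of u has been matched.  The effect of a
-- pattern on all r! arrangements is therefore a vector of r! positions in
-- {0, ..., n}, n being the length of u, and one more block sends such a vector to
-- one of two successors.  The number of further blocks after which every pattern
-- is certain to complete a match is 0 if some position is n, and one more than
-- the maximum over the two successors otherwise; at the zero vector it is fw(u)
-- (isFormationWidth).  As long as no position is n, a block moves every position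
-- forward, because it contains all letters of u.  Hence the code of a vector, read
-- as a number in base n + 1, increases, and a table indexed by the codes can be
-- filled from the top down (whole-table).
--
-- The table has (n + 1) ^ r! entries.  The multiplications by n + 1 that build a
-- code are repeated additions, so that an entry takes O(n) steps, and everything
-- is done within O((n + 1) ^ (r! + 1)) steps (program-runs).  As n is positive,
-- replacing n + 1 by n costs the factor 2 ^ (r! + 1).

open import Data.Nat.Base using (ℕ; _+_; _≤_; _!)
open import Data.Product.Base using (_×_; Σ-syntax)
open import Defs

open import Relation.Binary.PropositionalEquality
  using (_≡_; _≢_; refl; sym; trans; cong; cong₂; subst; subst₂; setoid)
open import Data.Bool.Base using (Bool; true; false; T)
open import Data.List.Base
  using (List; []; _∷_; [_]; _++_; map; concat; concatMap; length; reverse; filter;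
    foldl; zipWith; replicate; upTo; applyDownFrom; drop; deduplicate)
open import Data.List.Membership.Propositional using (_∈_; _∉_; find)
open import Data.List.Membership.Propositional.Properties
open import Data.List.Properties
open import Data.List.Relation.Binary.Permutation.Propositional
  using (_↭_; prep; ↭-refl; ↭-sym; ↭-trans; ↭⇒↭ₛ)
open import Data.List.Relation.Binary.Permutation.Propositional.Properties
  using (∈-resp-↭; ↭-map-inv; ↭-length; shift; drop-mid; ↭-reverse; ↭-empty-inv)
  renaming (map⁺ to ↭-map⁺)
open import Data.List.Relation.Binary.Permutation.Setoid.Properties (setoid ℕ)
  using (Unique-resp-↭)
open import Data.List.Relation.Binary.Pointwise.Base using (Pointwise; []; _∷_)
open import Data.List.Relation.Binary.Sublist.Propositional as Sub
  using (_⊆_; []; _∷_; _∷ʳ_; ⊆-refl; ⊆-trans; minimum)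
import Data.List.Relation.Binary.Sublist.Propositional.Properties as Subₚ
open import Data.List.Relation.Unary.All as All using (All; []; _∷_)
import Data.List.Relation.Unary.All.Properties as Allₚ
open import Data.List.Relation.Unary.AllPairs using ([]; _∷_)
open import Data.List.Relation.Unary.Any as Any using (Any; here; there)
import Data.List.Relation.Unary.Any.Properties as Anyₚ
open import Data.List.Relation.Unary.Unique.DecPropositional.Properties using (deduplicate-!)
open import Data.List.Relation.Unary.Unique.Propositional using (Unique)
import Data.List.Relation.Unary.Unique.Propositional.Properties as Uniqueₚ
open import Data.Nat.Base
  using (zero; suc; _*_; _∸_; _^_; _<_; _⊓_; _≡ᵇ_; z≤n; s≤s; z<s; s≤s⁻¹; >-nonZero; >-nonZero⁻¹)
open import Data.Nat.DivMod using (_%_; [m+kn]%n≡m%n; m<n⇒m%n≡m)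
open import Data.Nat.Properties
open import Data.Nat.Solver using (module +-*-Solver)
open import Data.Product.Base using (_,_; ∃-syntax; proj₁; proj₂)
open import Data.Sum.Base using (_⊎_; inj₁; inj₂)
open import Function.Base using (_∘_; id; case_of_; flip)
open import Relation.Nullary using (¬_; Dec; yes; no; contradiction)
open import Data.List.Membership.DecPropositional _≟_ using (_∈?_)

-- Repetition-free lists

-- A pigeonhole principle that keeps track of the elements left over.
unique-⊆⇒↭++ : ∀ {A : Set} {xs ys : List A} → Unique xs →
  (∀ {x} → x ∈ xs → x ∈ ys) → ∃[ zs ] xs ++ zs ↭ ys
unique-⊆⇒↭++ {ys = ys} [] _ = ys , ↭-refl
unique-⊆⇒↭++ {xs = x ∷ xs} (x∉ ∷ uniq) sub with ∈-∃++ (sub (here refl))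
... | as , bs , refl with unique-⊆⇒↭++ {ys = as ++ bs} uniq sub′
  where
  sub′ : ∀ {z} → z ∈ xs → z ∈ as ++ bs
  sub′ {z} z∈ with ∈-++⁻ as (sub (there z∈))
  ... | inj₁ z∈as = ∈-++⁺ˡ z∈as
  ... | inj₂ (here refl) = contradiction refl (All.lookup x∉ z∈)
  ... | inj₂ (there z∈bs) = ∈-++⁺ʳ as z∈bs
... | zs , p = zs , ↭-trans (prep x p) (↭-sym (shift x as bs))

unique-⊆⇒length≤ : ∀ {A : Set} {xs ys : List A} → Unique xs →
  (∀ {x} → x ∈ xs → x ∈ ys) → length xs ≤ length ys
unique-⊆⇒length≤ {xs = xs} uniq sub with unique-⊆⇒↭++ uniq sub
... | zs , p = subst (length xs ≤_)
  (trans (sym (length-++ xs)) (↭-length p)) (m≤m+n _ _)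

unique-⊆⊇⇒↭ : ∀ {A : Set} {xs ys : List A} → Unique xs → Unique ys →
  (∀ {x} → x ∈ xs → x ∈ ys) → (∀ {x} → x ∈ ys → x ∈ xs) → xs ↭ ys
unique-⊆⊇⇒↭ {xs = xs} ux uy sub sup with unique-⊆⇒↭++ ux sub
... | [] , p = subst (_↭ _) (++-identityʳ xs) p
... | z ∷ zs , p = contradiction (unique-⊆⇒length≤ uy sup)
  (<⇒≱ (subst (length xs <_) (trans (sym (length-++ xs)) (↭-length p))
    (m<m+n (length xs) z<s)))

unique-⊆ : ∀ {A : Set} {xs ys : List A} → xs ⊆ ys → Unique ys → Unique xs
unique-⊆ [] u = u
unique-⊆ (y ∷ʳ τ) (_ ∷ u) = unique-⊆ τ u
unique-⊆ (refl ∷ τ) (p ∷ u) = Subₚ.All-resp-⊆ τ p ∷ unique-⊆ τ u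

-- Injectivity on the elements of a list, the condition that the renaming of an
-- isomorphism of sequences satisfies.
InjectiveOn : List ℕ → (ℕ → ℕ) → Set
InjectiveOn xs f = ∀ {x y} → x ∈ xs → y ∈ xs → f x ≡ f y → x ≡ y

map-unique : ∀ {xs f} → InjectiveOn xs f → Unique xs → Unique (map f xs)
map-unique inj [] = []
map-unique {x ∷ xs} {f} inj (p ∷ u) =
  Allₚ.map⁺ (All.tabulate λ y∈ eq → All.lookup p y∈ (inj (here refl) (there y∈) eq))
  ∷ map-unique (λ x∈ y∈ → inj (there x∈) (there y∈)) u

map-⊆-reflects : ∀ {zs f} → InjectiveOn zs f → ∀ {xs ys} →
  (∀ {x} → x ∈ xs → x ∈ zs) → (∀ {y} → y ∈ ys → y ∈ zs) →
  map f xs ⊆ map f ys → xs ⊆ ys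
map-⊆-reflects inj {[]} xz yz τ = minimum _
map-⊆-reflects inj {x ∷ xs} {y ∷ ys} xz yz (_ ∷ʳ τ) =
  y ∷ʳ map-⊆-reflects inj xz (yz ∘ there) τ
map-⊆-reflects inj {x ∷ xs} {y ∷ ys} xz yz (eq ∷ τ) =
  inj (xz (here refl)) (yz (here refl)) eq
  ∷ map-⊆-reflects inj (xz ∘ there) (yz ∘ there) τ

-- The renaming that carries xs to ys letter by letter, for repetition-free lists
-- of equal length; other letters stay where they are.
rename : List ℕ → List ℕ → ℕ → ℕ
rename (x ∷ xs) (y ∷ ys) z with z ≟ x
... | yes _ = y
... | no _ = rename xs ys z
rename _ _ z = z

rename-here : ∀ x xs y ys → rename (x ∷ xs) (y ∷ ys) x ≡ y
rename-here x xs y ys with x ≟ x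
... | yes _ = refl
... | no x≢x = contradiction refl x≢x

rename-there : ∀ {x z} xs y ys → x ≢ z → rename (x ∷ xs) (y ∷ ys) z ≡ rename xs ys z
rename-there {x} {z} xs y ys x≢z with z ≟ x
... | yes z≡x = contradiction (sym z≡x) x≢z
... | no _ = refl

map-rename : ∀ {xs ys} → Unique xs → length xs ≡ length ys →
  map (rename xs ys) xs ≡ ys
map-rename {[]} {[]} _ _ = refl
map-rename {x ∷ xs} {y ∷ ys} (x∉ ∷ u) eq = cong₂ _∷_ (rename-here x xs y ys)
  (trans (map-cong-local (All.map (rename-there xs y ys) x∉)) (map-rename u (suc-injective eq)))

rename-injective : ∀ {xs ys} → Unique xs → Unique ys → length xs ≡ length ys →
  InjectiveOn xs (rename xs ys)
rename-injective {xs} {ys} ux uy eq = map-unique⁻ (subst Unique (sym (map-rename ux eq)) uy)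
  where
  map-unique⁻ : ∀ {zs} {f : ℕ → ℕ} → Unique (map f zs) → InjectiveOn zs f
  map-unique⁻ u (here refl) (here refl) _ = refl
  map-unique⁻ {f = f} (p ∷ u) (here refl) (there y∈) e = contradiction e (All.lookup p (∈-map⁺ f y∈))
  map-unique⁻ {f = f} (p ∷ u) (there x∈) (here refl) e = contradiction (sym e) (All.lookup p (∈-map⁺ f x∈))
  map-unique⁻ (p ∷ u) (there x∈) (there y∈) e = map-unique⁻ u x∈ y∈ e

-- Enumerating the permutations of a list

-- All ways of inserting x into a list.
insertions : ∀ {A : Set} → A → List A → List (List A)
insertions x [] = [ [ x ] ]
insertions x (y ∷ ys) = (x ∷ y ∷ ys) ∷ map (y ∷_) (insertions x ys)

-- All permutations of a list, with multiplicity if an element is repeated.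
permutations : ∀ {A : Set} → List A → List (List A)
permutations [] = [ [] ]
permutations (x ∷ xs) = concatMap (insertions x) (permutations xs)

insertions-complete : ∀ {A : Set} {x : A} as {bs} → as ++ x ∷ bs ∈ insertions x (as ++ bs)
insertions-complete [] {[]} = here refl
insertions-complete [] {b ∷ bs} = here refl
insertions-complete (a ∷ as) = there (∈-map⁺ (a ∷_) (insertions-complete as))

insertions-sound : ∀ {A : Set} {x : A} {xs ys} → ys ∈ insertions x xs → ys ↭ x ∷ xs
insertions-sound {xs = []} (here refl) = ↭-refl
insertions-sound {xs = z ∷ xs} (here refl) = ↭-refl
insertions-sound {x = x} {xs = z ∷ xs} (there ys∈) with ∈-map⁻ (z ∷_) ys∈
... | zs , zs∈ , refl = ↭-trans (prep z (insertions-sound zs∈)) (shift x [ z ] xs)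

permutations-complete : ∀ {A : Set} xs {ys : List A} → ys ↭ xs → ys ∈ permutations xs
permutations-complete [] p rewrite ↭-empty-inv p = here refl
permutations-complete (x ∷ xs) p with ∈-∃++ (∈-resp-↭ (↭-sym p) (here refl))
... | as , bs , refl = ∈-concatMap⁺ (insertions x)
  (Any.map (λ { refl → insertions-complete as }) (permutations-complete xs (drop-mid as [] p)))

permutations-sound : ∀ {A : Set} (xs : List A) {ys} → ys ∈ permutations xs → ys ↭ xs
permutations-sound [] (here refl) = ↭-refl
permutations-sound (x ∷ xs) ys∈
  with zs , zs∈ , ys∈′ ← find (∈-concatMap⁻ (insertions x) {xs = permutations xs} ys∈)
  = ↭-trans (insertions-sound ys∈′) (prep x (permutations-sound xs zs∈))

length-insertions : ∀ {A : Set} (x : A) ys → length (insertions x ys) ≡ suc (length ys)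
length-insertions x [] = refl
length-insertions x (y ∷ ys) =
  cong suc (trans (length-map _ (insertions x ys)) (length-insertions x ys))

length-permutations : ∀ {A : Set} (xs : List A) → length (permutations xs) ≡ length xs !
length-permutations [] = refl
length-permutations (x ∷ xs) = trans
  (go (permutations xs) (All.tabulate λ zs∈ → ↭-length (permutations-sound xs zs∈)))
  (cong (suc (length xs) *_) (length-permutations xs))
  where
  go : ∀ zss → All (λ zs → length zs ≡ length xs) zss →
    length (concatMap (insertions x) zss) ≡ suc (length xs) * length zss
  go [] [] = sym (*-zeroʳ (length xs))
  go (zs ∷ zss) (eq ∷ eqs) = trans (length-++ (insertions x zs)) (trans
    (cong₂ _+_ (trans (length-insertions x zs) (cong suc eq)) (go zss eqs))
    (sym (*-suc (suc (length xs)) (length zss))))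

-- Binary formations

-- Which blocks of a binary formation are reversed: true keeps the order.
Pattern : Set
Pattern = List Bool

-- One block of a binary formation.
orient : ∀ {A : Set} → List A → Bool → List A
orient xs true  = xs
orient xs false = reverse xs

-- The binary formation on xs with pattern f.
binary : List ℕ → Pattern → Sequence
binary xs f = concat (map (orient xs) f)

orient-map : ∀ {A B : Set} (g : A → B) xs b → orient (map g xs) b ≡ map g (orient xs b)
orient-map g xs true = refl
orient-map g xs false = sym (reverse-map g xs)

binary-map : ∀ g xs f → binary (map g xs) f ≡ map g (binary xs f)
binary-map g xs f = trans
  (cong concat (trans (map-cong (orient-map g xs) f) (map-∘ f)))
  (concat-map (map (orient xs) f))

orient-↭ : ∀ {A : Set} (xs : List A) b → orient xs b ↭ xs
orient-↭ xs true = ↭-refl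
orient-↭ xs false = ↭-reverse xs

orient-⊆ : ∀ {A : Set} {xs ys : List A} → xs ⊆ ys → ∀ b → orient xs b ⊆ orient ys b
orient-⊆ τ true = τ
orient-⊆ τ false = Subₚ.reverse⁺ τ

binary-∈ : ∀ xs f {x} → x ∈ binary xs f → x ∈ xs
binary-∈ xs (b ∷ f) x∈ with ∈-++⁻ (orient xs b) x∈
... | inj₁ x∈b = ∈-resp-↭ (orient-↭ xs b) x∈b
... | inj₂ x∈f = binary-∈ xs f x∈f

module _ {P : ℕ → Set} (P? : ∀ x → Dec (P x)) where

  filter-reverse : ∀ xs → filter P? (reverse xs) ≡ reverse (filter P? xs)
  filter-reverse [] = refl
  filter-reverse (x ∷ xs) rewrite unfold-reverse x xs | filter-++ P? (reverse xs) [ x ]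
    with P? x
  ... | yes _ = trans (cong (_++ [ x ]) (filter-reverse xs)) (sym (unfold-reverse x (filter P? xs)))
  ... | no _ = trans (++-identityʳ _) (filter-reverse xs)

  filter-orient : ∀ xs b → filter P? (orient xs b) ≡ orient (filter P? xs) b
  filter-orient xs true = refl
  filter-orient xs false = filter-reverse xs

  filter-binary : ∀ xs f → filter P? (binary xs f) ≡ binary (filter P? xs) f
  filter-binary xs [] = refl
  filter-binary xs (b ∷ f) = trans (filter-++ P? (orient xs b) (binary xs f))
    (cong₂ _++_ (filter-orient xs b) (filter-binary xs f))

binary-isFormation : ∀ {xs} → Unique xs → ∀ f →
  IsFormation (length xs) (length f) (binary xs f)
binary-isFormation {xs} u f =
  xs , map (orient xs) f , u , refl , length-map _ f ,
  Allₚ.map⁺ (All.universal (orient-↭ xs) f) , refl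

-- The letters of u, listed without repetition in the order ds.
IsAlphabet : Sequence → List ℕ → Set
IsAlphabet u ds = Unique ds × (∀ {x} → x ∈ u → x ∈ ds) × (∀ {x} → x ∈ ds → x ∈ u)

-- A copy of u in the binary formation with pattern f on many letters uses a set
-- of r of them; deleting the others leaves a binary formation with the same
-- pattern.
forces⇒binary : ∀ {u ds s} → IsAlphabet u ds → Forces s u → ∀ f → length f ≡ s →
  ∃[ π ] π ↭ ds × u ⊆ binary π f
forces⇒binary {u} {ds} {s} (uds , u⊆ds , ds⊆u) (r′ , contains) f refl
  with contains (binary (upTo r′) f)
    (subst (λ k → IsFormation k (length f) (binary (upTo r′) f)) (length-upTo r′)
      (binary-isFormation (Uniqueₚ.upTo⁺ r′) f))
... | w , w⊆ , φ , inj , refl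
  with ↭-map-inv φ (unique-⊆⊇⇒↭
    (map-unique (λ x∈ y∈ → inj (ds⊆u x∈) (ds⊆u y∈)) uds)
    (Uniqueₚ.filter⁺ (_∈? map φ ds) (Uniqueₚ.upTo⁺ r′))
    (λ x∈ → ∈-filter⁺ (_∈? map φ ds) (in-range x∈) x∈)
    (λ x∈ → proj₂ (∈-filter⁻ (_∈? map φ ds) {xs = upTo r′} x∈)))
  where
  in-range : ∀ {x} → x ∈ map φ ds → x ∈ upTo r′
  in-range x∈ with ∈-map⁻ φ x∈
  ... | d , d∈ , refl = binary-∈ (upTo r′) f (Sub.lookup w⊆ (∈-map⁺ φ (ds⊆u d∈)))
... | π , ys≡ , ds↭π = π , ↭-sym ds↭π ,
  map-⊆-reflects inj id (λ y∈ → ds⊆u (∈-resp-↭ (↭-sym ds↭π) (binary-∈ π f y∈)))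
    (subst₂ _⊆_ (filter-all (_∈? map φ ds) all-in)
      (trans (filter-binary (_∈? map φ ds) (upTo r′) f)
        (trans (cong (λ ys → binary ys f) ys≡) (binary-map φ π f)))
      (Subₚ.filter⁺ (_∈? map φ ds) (_∈? map φ ds) (λ { refl → id }) w⊆))
  where
  all-in : All (_∈ map φ ds) (map φ u)
  all-in = Allₚ.map⁺ (All.tabulate λ x∈ → ∈-map⁺ φ (u⊆ds x∈))

-- Ramsey theory

splitAll : ∀ {A : Set} {P Q : A → Set} {xs} → All (λ x → P x ⊎ Q x) xs →
  ∃[ ys ] ∃[ zs ] ys ⊆ xs × zs ⊆ xs × All P ys × All Q zs ×
    length ys + length zs ≡ length xs
splitAll [] = [] , [] , [] , [] , [] , [] , refl
splitAll {xs = x ∷ xs} (pq ∷ pqs) with splitAll pqs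
... | ys , zs , ys⊆ , zs⊆ , ps , qs , eq with pq
... | inj₁ p = x ∷ ys , zs , refl ∷ ys⊆ , x ∷ʳ zs⊆ , p ∷ ps , qs , cong suc eq
... | inj₂ q = ys , x ∷ zs , x ∷ʳ ys⊆ , refl ∷ zs⊆ , ps , q ∷ qs ,
  trans (+-suc (length ys) (length zs)) (cong suc eq)

-- Length of a repetition-free list that guarantees a sublist of length a in the order of a given
-- list or one of length b in the reverse order.
ramsey : ℕ → ℕ → ℕ
ramsey zero b = zero
ramsey (suc a) zero = zero
ramsey (suc a) (suc b) = suc (ramsey (suc a) b + ramsey a (suc b))

+-≤-split : ∀ {a b} c d → a + b ≤ c + d → a ≤ c ⊎ b ≤ d
+-≤-split {a} {b} c d le with a ≤? c
... | yes a≤c = inj₁ a≤c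
... | no a≰c with b ≤? d
... | yes b≤d = inj₂ b≤d
... | no b≰d = contradiction le (<⇒≱ (+-mono-< (≰⇒> a≰c) (≰⇒> b≰d)))

-- The head x splits p into the part before x and the part after x.  If many of
-- the remaining elements lie after x, a sublist in the order of p can be extended
-- by x; if many lie before x, a sublist in reverse order can.
monotone-sublist : ∀ a b {xs p : List ℕ} → Unique xs → All (_∈ p) xs →
  ramsey a b ≤ length xs →
  ∃[ ys ] ys ⊆ xs × ((length ys ≡ a × ys ⊆ p) ⊎ (length ys ≡ b × reverse ys ⊆ p))
monotone-sublist zero b _ _ _ = [] , minimum _ , inj₁ (refl , minimum _)
monotone-sublist (suc a) zero _ _ _ = [] , minimum _ , inj₂ (refl , minimum _)
monotone-sublist (suc a) (suc b) {x ∷ xs} (x∉ ∷ u) (x∈ ∷ xs∈) (s≤s le) with ∈-∃++ x∈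
... | p₁ , p₂ , refl with splitAll (All.zipWith side (x∉ , xs∈))
  where
  side : ∀ {y} → x ≢ y × y ∈ p₁ ++ x ∷ p₂ → y ∈ p₁ ⊎ y ∈ p₂
  side (x≢y , y∈) with ∈-++⁻ p₁ y∈
  ... | inj₁ y∈₁ = inj₁ y∈₁
  ... | inj₂ (here y≡x) = contradiction (sym y≡x) x≢y
  ... | inj₂ (there y∈₂) = inj₂ y∈₂
... | ys , zs , ys⊆ , zs⊆ , ys∈ , zs∈ , eq
  with +-≤-split (length ys) (length zs) (subst (_ ≤_) (sym eq) le)
... | inj₁ le₁ = extend (monotone-sublist (suc a) b (unique-⊆ ys⊆ u) ys∈ le₁)
  where
  extend : (∃[ vs ] vs ⊆ ys × ((length vs ≡ suc a × vs ⊆ p₁) ⊎ (length vs ≡ b × reverse vs ⊆ p₁))) → _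
  extend (vs , vs⊆ , inj₁ (len , τ)) =
    vs , x ∷ʳ ⊆-trans vs⊆ ys⊆ , inj₁ (len , Subₚ.++⁺ʳ (x ∷ p₂) τ)
  extend (vs , vs⊆ , inj₂ (len , τ)) =
    x ∷ vs , refl ∷ ⊆-trans vs⊆ ys⊆ , inj₂ (cong suc len ,
      subst (_⊆ _) (sym (unfold-reverse x vs)) (Subₚ.++⁺ τ (refl ∷ minimum p₂)))
... | inj₂ le₂ = extend (monotone-sublist a (suc b) (unique-⊆ zs⊆ u) zs∈ le₂)
  where
  extend : (∃[ vs ] vs ⊆ zs × ((length vs ≡ a × vs ⊆ p₂) ⊎ (length vs ≡ suc b × reverse vs ⊆ p₂))) → _
  extend (vs , vs⊆ , inj₁ (len , τ)) =
    x ∷ vs , refl ∷ ⊆-trans vs⊆ zs⊆ , inj₁ (cong suc len , Subₚ.++⁺ˡ p₁ (refl ∷ τ))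
  extend (vs , vs⊆ , inj₂ (len , τ)) =
    vs , x ∷ʳ ⊆-trans vs⊆ zs⊆ , inj₂ (len , Subₚ.++⁺ˡ p₁ (x ∷ʳ τ))

-- The Ramsey bound iterated over s permutations.
ramseyIter : ℕ → ℕ → ℕ
ramseyIter r zero = r
ramseyIter r (suc s) = ramsey (ramseyIter r s) (ramseyIter r s)

some-orientation : ∀ {a} {ys p : List ℕ} →
  (length ys ≡ a × ys ⊆ p) ⊎ (length ys ≡ a × reverse ys ⊆ p) →
  length ys ≡ a × ∃[ b ] orient ys b ⊆ p
some-orientation (inj₁ (eq , τ)) = eq , true , τ
some-orientation (inj₂ (eq , τ)) = eq , false , τ

-- Each permutation in turn thins out xs to a sublist that it contains in order or
-- in reverse.
binary-subformation : ∀ r {xs} perms → Unique xs → All (λ p → All (_∈ p) xs) perms →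
  length xs ≡ ramseyIter r (length perms) →
  ∃[ ys ] ∃[ f ] ys ⊆ xs × length ys ≡ r × length f ≡ length perms × binary ys f ⊆ concat perms
binary-subformation r {xs} [] u _ le = xs , [] , ⊆-refl , le , refl , []
binary-subformation r {xs} (p ∷ perms) u (xs∈p ∷ xs∈) le
  with ys , ys⊆xs , mono ← monotone-sublist _ _ u xs∈p (≤-reflexive (sym le))
  with len , b , ys⊆p ← some-orientation mono
  with zs , f , zs⊆ys , le′ , lenf , zs⊆ ← binary-subformation r perms (unique-⊆ ys⊆xs u)
    (All.map (Subₚ.All-resp-⊆ ys⊆xs) xs∈) len
  = zs , b ∷ f , ⊆-trans zs⊆ys ys⊆xs , le′ , cong suc lenf ,
    Subₚ.++⁺ (⊆-trans (orient-⊆ zs⊆ys b) ys⊆p) zs⊆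

-- An arrangement π of the alphabet with u inside binary π f yields a copy of u in
-- binary ys f, by the renaming that takes π to ys.
binary⇒forces : ∀ {u ds s} → IsAlphabet u ds →
  (∀ f → length f ≡ s → ∃[ π ] π ↭ ds × u ⊆ binary π f) → Forces s u
binary⇒forces {u} {ds} {s} (uds , u⊆ds , ds⊆u) bin = ramseyIter (length ds) s , contains
  where
  contains : ∀ w → IsFormation (ramseyIter (length ds) s) s w → w Contains u
  contains w (letters , perms , ul , len , refl , perm , refl)
    with ys , f , ys⊆ , lenys , lenf , bin⊆ ← binary-subformation (length ds) perms ul
      (All.map (λ p↭ → All.tabulate (∈-resp-↭ (↭-sym p↭))) perm) len
    with π , π↭ , u⊆ ← bin f lenf
    = map (φ π ys) u ,
      ⊆-trans (Subₚ.map⁺ _ u⊆) (subst (_⊆ concat perms) (binary-φ π ys f π↭ lenys) bin⊆) ,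
      φ π ys ,
      (λ x∈ y∈ → rename-injective (uπ π↭) (unique-⊆ ys⊆ ul) (lenπ π ys π↭ lenys)
        (inπ π↭ x∈) (inπ π↭ y∈)) ,
      refl
    where
    φ = rename
    uπ : ∀ {π} → π ↭ ds → Unique π
    uπ π↭ = Unique-resp-↭ (↭⇒↭ₛ (↭-sym π↭)) uds
    lenπ : ∀ π (ys : List ℕ) → π ↭ ds → length ys ≡ length ds → length π ≡ length ys
    lenπ π ys π↭ eq = trans (↭-length π↭) (sym eq)
    binary-φ : ∀ π ys f → π ↭ ds → length ys ≡ length ds →
      binary ys f ≡ map (φ π ys) (binary π f)
    binary-φ π ys f π↭ eq = trans (cong (λ zs → binary zs f) (sym (map-rename (uπ π↭) (lenπ π ys π↭ eq))))
      (binary-map (φ π ys) π f)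
    inπ : ∀ {π x} → π ↭ ds → x ∈ u → x ∈ π
    inπ π↭ x∈ = ∈-resp-↭ (↭-sym π↭) (u⊆ds x∈)

-- Greedy matching

-- One step of greedy matching: if a is the letter at position p of u, move on to
-- the next position.  The position length u stands for a complete match and is
-- never left.  The letter test is written as the machine computes it: 1 is added
-- when the sum of the two truncated differences and of the guard is 0, and the
-- guard is 1 exactly at the end of u.
advance : Sequence → ℕ → ℕ → ℕ
advance u p a = p + (1 ∸ (((cells u p ∸ a) + (a ∸ cells u p)) + (1 ∸ (length u ∸ p))))

-- The position reached by greedy matching of a whole word, starting from p.
scan : Sequence → ℕ → List ℕ → ℕ
scan u = foldl (advance u)

∸+∸≡0⇒≡ : ∀ a b → (a ∸ b) + (b ∸ a) ≡ 0 → a ≡ b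
∸+∸≡0⇒≡ a b eq = ≤-antisym (m∸n≡0⇒m≤n (m+n≡0⇒m≡0 (a ∸ b) eq))
  (m∸n≡0⇒m≤n (m+n≡0⇒n≡0 (a ∸ b) eq))

∸+∸-refl : ∀ a → (a ∸ a) + (a ∸ a) ≡ 0
∸+∸-refl a rewrite n∸n≡0 a = refl

1∸≢0 : ∀ {k} → k ≢ 0 → 1 ∸ k ≡ 0
1∸≢0 {zero} k≢0 = contradiction refl k≢0
1∸≢0 {suc k} _ = 0∸n≡0 k

inside-guard : ∀ (u : Sequence) p → p < length u → 1 ∸ (length u ∸ p) ≡ 0
inside-guard u p p<n = 1∸≢0 (m>n⇒m∸n≢0 p<n)

-- The value of advance from those of the letter test, the guard and the summand.
advance-by : ∀ u p a {d g k} → (cells u p ∸ a) + (a ∸ cells u p) ≡ d →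
  1 ∸ (length u ∸ p) ≡ g → 1 ∸ (d + g) ≡ k → advance u p a ≡ p + k
advance-by u p a eq₁ eq₂ eq₃ =
  cong (p +_) (trans (cong (1 ∸_) (cong₂ _+_ eq₁ eq₂)) eq₃)

advance-end : ∀ u p a → length u ≤ p → advance u p a ≡ p
advance-end u p a n≤p = trans
  (advance-by u p a {d} refl (cong (1 ∸_) (m≤n⇒m∸n≡0 n≤p)) (1∸≢0 (subst (_≢ 0) (+-comm 1 d) λ ())))
  (+-identityʳ p)
  where d = (cells u p ∸ a) + (a ∸ cells u p)

advance-match : ∀ u p → p < length u → advance u p (cells u p) ≡ suc p
advance-match u p p<n = trans
  (advance-by u p (cells u p) (∸+∸-refl (cells u p)) (inside-guard u p p<n) refl) (+-comm p 1)

advance-mismatch : ∀ u p a → p < length u → cells u p ≢ a → advance u p a ≡ p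
advance-mismatch u p a p<n neq = trans
  (advance-by u p a {d} refl (inside-guard u p p<n)
    (1∸≢0 (subst (_≢ 0) (sym (+-identityʳ d)) (neq ∘ ∸+∸≡0⇒≡ (cells u p) a))))
  (+-identityʳ p)
  where d = (cells u p ∸ a) + (a ∸ cells u p)

advance-≥ : ∀ u p a → p ≤ advance u p a
advance-≥ u p a = m≤m+n p _

advance-≤ : ∀ u p a → p ≤ length u → advance u p a ≤ length u
advance-≤ u p a p≤n with length u ≤? p
... | yes n≤p = subst (_≤ length u) (sym (advance-end u p a n≤p)) p≤n
... | no n≰p = ≤-trans
  (+-monoʳ-≤ p (m∸n≤m 1 (((cells u p ∸ a) + (a ∸ cells u p)) + (1 ∸ (length u ∸ p)))))
  (subst (_≤ length u) (+-comm 1 p) (≰⇒> n≰p))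

scan-≥ : ∀ u p W → p ≤ scan u p W
scan-≥ u p [] = ≤-refl
scan-≥ u p (a ∷ W) = ≤-trans (advance-≥ u p a) (scan-≥ u (advance u p a) W)

scan-≤ : ∀ u p W → p ≤ length u → scan u p W ≤ length u
scan-≤ u p [] p≤n = p≤n
scan-≤ u p (a ∷ W) p≤n = scan-≤ u (advance u p a) W (advance-≤ u p a p≤n)

scan-progress : ∀ u p W → p < length u → cells u p ∈ W → p < scan u p W
scan-progress u p (a ∷ W) p<n (here refl) rewrite advance-match u p p<n = scan-≥ u (suc p) W
scan-progress u p (a ∷ W) p<n (there x∈) with cells u p ≟ a
... | yes refl rewrite advance-match u p p<n = scan-≥ u (suc p) W
... | no neq rewrite advance-mismatch u p a p<n neq = scan-progress u p W p<n x∈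

drop-cells : ∀ u p → p < length u → drop p u ≡ cells u p ∷ drop (suc p) u
drop-cells (x ∷ u) zero _ = refl
drop-cells (x ∷ u) (suc p) (s≤s p<n) = drop-cells u p p<n

cells-∈ : ∀ u p → p < length u → cells u p ∈ u
cells-∈ (x ∷ u) zero _ = here refl
cells-∈ (x ∷ u) (suc p) (s≤s p<n) = there (cells-∈ u p p<n)

scan-complete : ∀ u p W → drop p u ⊆ W → length u ≤ scan u p W
scan-complete u p W τ with length u ≤? p
... | yes n≤p = ≤-trans n≤p (scan-≥ u p W)
scan-complete u p [] τ | no n≰p rewrite drop-cells u p (≰⇒> n≰p) = case τ of λ ()
scan-complete u p (a ∷ W) τ | no n≰p with cells u p ≟ a
... | yes refl rewrite advance-match u p (≰⇒> n≰p) =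
  scan-complete u (suc p) W
    (Subₚ.∷⁻ (subst (_⊆ cells u p ∷ W) (drop-cells u p (≰⇒> n≰p)) τ))
... | no neq rewrite advance-mismatch u p a (≰⇒> n≰p) neq =
  scan-complete u p W (subst (_⊆ W) (sym eq) (skip-head neq (subst (_⊆ a ∷ W) eq τ)))
  where
  eq = drop-cells u p (≰⇒> n≰p)
  skip-head : ∀ {x xs} → x ≢ a → x ∷ xs ⊆ a ∷ W → x ∷ xs ⊆ W
  skip-head x≢a (_ ∷ʳ τ) = τ
  skip-head x≢a (x≡a ∷ _) = contradiction x≡a x≢a

scan-sound : ∀ u p W → length u ≤ scan u p W → drop p u ⊆ W
scan-sound u p W le with length u ≤? p
... | yes n≤p rewrite drop-all p u n≤p = minimum W
scan-sound u p [] le | no n≰p = contradiction le n≰p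
scan-sound u p (a ∷ W) le | no n≰p with cells u p ≟ a
... | yes refl rewrite advance-match u p (≰⇒> n≰p) | drop-cells u p (≰⇒> n≰p) =
  refl ∷ scan-sound u (suc p) W le
... | no neq rewrite advance-mismatch u p a (≰⇒> n≰p) neq = a ∷ʳ scan-sound u p W le

-- Configurations

-- The sum a + (b ∸ a) is the maximum of a and b in the operations of the machine.
<-a+[b∸a]⇒ : ∀ a b {k} → k < a + (b ∸ a) → k < a ⊎ k < b
<-a+[b∸a]⇒ a b {k} lt with ≤-total a b
... | inj₁ a≤b = inj₂ (subst (k <_) (m+[n∸m]≡n a≤b) lt)
... | inj₂ b≤a = inj₁ (subst (k <_) (trans (cong (a +_) (m≤n⇒m∸n≡0 b≤a)) (+-identityʳ a)) lt)

module Configurations (u : Sequence) (Π : List (List ℕ)) where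

  -- A configuration is a list of positions in u, one for every arrangement in Π.
  -- A block with orientation b moves all of them by greedy matching.
  step : Bool → List ℕ → List ℕ
  step b = zipWith (λ π p → scan u p (orient π b)) Π

  -- Some arrangement has completed a match.
  Finished : List ℕ → Set
  Finished = Any (length u ≤_)

  -- Width v s: s is the least length such that every pattern of that length
  -- leads from v to a finished configuration.
  data Width (v : List ℕ) : ℕ → Set where
    finished : Finished v → Width v 0
    running : ∀ {a b} → ¬ Finished v →
      Width (step true v) a → Width (step false v) b → Width v (suc (a + (b ∸ a)))

  run : List ℕ → Pattern → List ℕ
  run = foldl (flip step)

  step-finished : ∀ b {v} → length v ≡ length Π → Finished v → Finished (step b v)
  step-finished b {v} eq = go Π v eq
    where
    go : ∀ Π v → length v ≡ length Π → Finished v →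
      Finished (zipWith (λ π p → scan u p (orient π b)) Π v)
    go (π ∷ Π) (p ∷ v) eq (here n≤p) = here (≤-trans n≤p (scan-≥ u p (orient π b)))
    go (π ∷ Π) (p ∷ v) eq (there fin) = there (go Π v (suc-injective eq) fin)

  length-step : ∀ b {v} → length v ≡ length Π → length (step b v) ≡ length Π
  length-step b {v} eq = trans (length-zipWith _ Π v) (trans (cong (length Π ⊓_) eq) (⊓-idem _))

  run-finished : ∀ f {v} → length v ≡ length Π → Finished v → Finished (run v f)
  run-finished [] eq fin = fin
  run-finished (b ∷ f) eq fin = run-finished f (length-step b eq) (step-finished b eq fin)

  width-sound : ∀ {v s} → length v ≡ length Π → Width v s →
    ∀ f → s ≤ length f → Finished (run v f)
  width-sound len (finished fin) f _ = run-finished f len fin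
  width-sound len (running {a} {b} _ wI wD) (true ∷ f) (s≤s le) =
    width-sound (length-step true len) wI f (≤-trans (m≤m+n a (b ∸ a)) le)
  width-sound len (running {a} {b} _ wI wD) (false ∷ f) (s≤s le) =
    width-sound (length-step false len) wD f (≤-trans (m≤n+m∸n b a) le)

  -- Each block leads into a branch whose width exceeds the number of blocks still
  -- to come.
  width-least : ∀ {v s} → Width v s → ∀ {s′} → s′ < s →
    ∃[ f ] length f ≡ s′ × ¬ Finished (run v f)
  width-least (running ¬fin _ _) {zero} _ = [] , refl , ¬fin
  width-least (running {a} {b} _ wI wD) {suc s′} (s≤s lt) with <-a+[b∸a]⇒ a b lt
  ... | inj₁ s′<a with f , eq , ¬fin ← width-least wI s′<a = true ∷ f , cong suc eq , ¬fin
  ... | inj₂ s′<b with f , eq , ¬fin ← width-least wD s′<b = false ∷ f , cong suc eq , ¬fin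

  run-zipWith : ∀ v f → length v ≡ length Π → run v f ≡ zipWith (λ π p → scan u p (binary π f)) Π v
  run-zipWith v [] len = sym (zipWith-right Π v len)
    where
    zipWith-right : ∀ (Π : List (List ℕ)) v → length v ≡ length Π → zipWith (λ π p → p) Π v ≡ v
    zipWith-right [] [] _ = refl
    zipWith-right (π ∷ Π) (p ∷ v) eq = cong (p ∷_) (zipWith-right Π v (suc-injective eq))
  run-zipWith v (b ∷ f) len = trans (run-zipWith (step b v) f (length-step b len)) (go Π v)
    where
    go : ∀ (Π : List (List ℕ)) v →
      zipWith (λ π p → scan u p (binary π f)) Π (zipWith (λ π p → scan u p (orient π b)) Π v)
      ≡ zipWith (λ π p → scan u p (binary π (b ∷ f))) Π v
    go [] v = refl
    go (π ∷ Π) [] = refl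
    go (π ∷ Π) (p ∷ v) = cong₂ _∷_ (sym (foldl-++ (advance u) p (orient π b) (binary π f))) (go Π v)

  -- Nothing has been matched yet.
  start : List ℕ
  start = replicate (length Π) 0

  run-start : ∀ f → run start f ≡ map (λ π → scan u 0 (binary π f)) Π
  run-start f = trans (run-zipWith start f (length-replicate (length Π))) (go Π)
    where
    go : ∀ (Π : List (List ℕ)) → zipWith (λ π p → scan u p (binary π f)) Π (replicate (length Π) 0)
      ≡ map (λ π → scan u 0 (binary π f)) Π
    go [] = refl
    go (π ∷ Π) = cong (_ ∷_) (go Π)

  finished⇔embeds : ∀ f →
    (Finished (run start f) → ∃[ π ] π ∈ Π × u ⊆ binary π f) ×
    (∀ {π} → π ∈ Π → u ⊆ binary π f → Finished (run start f))
  finished⇔embeds f rewrite run-start f =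
    (λ fin → let π , π∈ , le = find (Anyₚ.map⁻ fin) in π , π∈ , scan-sound u 0 _ le) ,
    (λ π∈ τ → Anyₚ.map⁺ (Any.map (λ { refl → scan-complete u 0 _ τ }) π∈))

  isFormationWidth : ∀ {ds s} → IsAlphabet u ds →
    (∀ {π} → π ∈ Π → π ↭ ds) → (∀ {π} → π ↭ ds → π ∈ Π) →
    Width start s → IsFormationWidth u s
  isFormationWidth {ds} {s} alphabet sound complete width = forces , least
    where
    forces : Forces s u
    forces = binary⇒forces alphabet λ f len →
      let π , π∈ , τ = proj₁ (finished⇔embeds f)
            (width-sound (length-replicate (length Π)) width f (≤-reflexive (sym len)))
      in π , sound π∈ , τ
    least : ∀ s′ → Forces s′ u → s ≤ s′
    least s′ forces′ = ≮⇒≥ λ s′<s →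
      let f , len , ¬fin = width-least width s′<s
          π , π↭ , τ = forces⇒binary alphabet forces′ f len
      in ¬fin (proj₂ (finished⇔embeds f) (complete π↭) τ)

-- Timed Hoare logic

-- Started in σ, p halts within c * M steps in a state satisfying Q.  In use, M is
-- a power of n + 1 for inputs of length n, and c depends on the program only.
record Runs (M c : ℕ) (p : Program) (σ : State) (Q : State → Set) : Set where
  constructor runs
  field
    {time}  : ℕ
    {final} : State
    exec    : ⟨ p , σ ⟩⇓[ time ] final
    bound   : time ≤ c * M
    post    : Q final

infixr 4 _>>_ _▷_

-- Weakening of the postcondition.
_▷_ : ∀ {M c p σ Q R} → Runs M c p σ Q → (∀ {τ} → Q τ → R τ) → Runs M c p σ R
runs d b q ▷ f = runs d b (f q)

raise : ∀ {M M′ c p σ Q} → M ≤ M′ → Runs M c p σ Q → Runs M′ c p σ Q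
raise {c = c} M≤M′ (runs d b q) = runs d (≤-trans b (*-monoʳ-≤ c M≤M′)) q

assign : ∀ {M x e σ} → 1 ≤ M →
  Runs M (suc (cost e)) (x ≔ e) σ (_≡ ⟪ regs σ [ x ↦ ⟦ e ⟧ σ ] , mem σ ⟫)
assign {M} {e = e} 1≤M = runs ⇓reg (m≤m*n (suc (cost e)) M {{>-nonZero 1≤M}}) refl

store : ∀ {M a e σ} → 1 ≤ M →
  Runs M (suc (cost a + cost e)) (mem[ a ]≔ e) σ
    (_≡ ⟪ regs σ , mem σ [ ⟦ a ⟧ σ ↦ ⟦ e ⟧ σ ] ⟫)
store {M} {a} {e} 1≤M = runs ⇓mem (m≤m*n (suc (cost a + cost e)) M {{>-nonZero 1≤M}}) refl

_>>_ : ∀ {M c c′ p q σ P Q} → Runs M c p σ P → (∀ {τ} → P τ → Runs M c′ q τ Q) →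
  Runs M (c + c′) (p ⨾ q) σ Q
_>>_ {M} {c} {c′} (runs d b q) f with f q
... | runs d′ b′ q′ = runs (⇓seq d d′)
  (≤-trans (+-mono-≤ b b′) (≤-reflexive (sym (*-distribʳ-+ M c c′)))) q′

plus-bound : ∀ {M t c} a → 1 ≤ M → t ≤ c * M → a + t ≤ (a + c) * M
plus-bound {M} {c = c} a 1≤M t≤ = ≤-trans
  (+-mono-≤ (m≤m*n a M {{>-nonZero 1≤M}}) t≤) (≤-reflexive (sym (*-distribʳ-+ M a c)))

branch : ∀ {M c c′ e p q σ Q} → 1 ≤ M →
  (⟦ e ⟧ σ ≢ 0 → Runs M c p σ Q) → (⟦ e ⟧ σ ≡ 0 → Runs M c′ q σ Q) →
  Runs M (suc (cost e) + (c + c′)) (ifNZ e p q) σ Q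
branch {M} {c} {c′} {e} {σ = σ} 1≤M then else with ⟦ e ⟧ σ ≟ 0
... | no nz = let runs d b q = then nz in runs (⇓if-nz nz d)
  (plus-bound (suc (cost e)) 1≤M (≤-trans b (*-monoˡ-≤ M (m≤m+n c c′)))) q
... | yes z = let runs d b q = else z in runs (⇓if-z z d)
  (plus-bound (suc (cost e)) 1≤M (≤-trans b (*-monoˡ-≤ M (m≤n+m c′ c)))) q

-- The first argument of the invariant I bounds the number of remaining
-- iterations; the test can only succeed while it is positive.
loop : ∀ {M c e p N} (I : ℕ → State → Set) → 1 ≤ M → 1 ≤ N →
  (∀ {k σ} → I k σ → ⟦ e ⟧ σ ≢ 0 → ∃[ k′ ] k ≡ suc k′ × Runs M c p σ (I k′)) →
  ∀ {k σ} → k ≤ N → I k σ →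
  Runs (N * M) (suc (cost e) + (suc (cost e) + c)) (whileNZ e p) σ
    (λ τ → ⟦ e ⟧ τ ≡ 0 × ∃[ k′ ] I k′ τ)
loop {M} {c} {e} {p} {N} I 1≤M 1≤N body {k} k≤N i =
  let runs d b q = iterate k i in runs d (≤-trans b total) q
  where
  E = suc (cost e)
  iterate : ∀ k {σ} → I k σ → Runs 1 (E + k * (E + c * M)) (whileNZ e p) σ
    (λ τ → ⟦ e ⟧ τ ≡ 0 × ∃[ k′ ] I k′ τ)
  iterate k {σ} i with ⟦ e ⟧ σ ≟ 0
  ... | yes z = runs (⇓while-z z)
    (subst (E ≤_) (sym (*-identityʳ _)) (m≤m+n E _)) (z , k , i)
  ... | no nz with body i nz
  ... | k′ , refl , runs d b i′ with iterate k′ i′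
  ... | runs d′ b′ q = runs (⇓while-nz nz d d′)
    (≤-trans (+-mono-≤ (+-monoʳ-≤ E b) b′) (≤-reflexive eq)) q
    where
    open +-*-Solver
    eq : E + c * M + (E + k′ * (E + c * M)) * 1 ≡ (E + suc k′ * (E + c * M)) * 1
    eq = solve 3 (λ E cM k → E :+ cM :+ (E :+ k :* (E :+ cM)) :* con 1
      := (E :+ (con 1 :+ k) :* (E :+ cM)) :* con 1) refl E (c * M) k′
  NM≥1 : 1 ≤ N * M
  NM≥1 = *-mono-≤ 1≤N 1≤M
  total : (E + k * (E + c * M)) * 1 ≤ (E + (E + c)) * (N * M)
  total = begin
    (E + k * (E + c * M)) * 1        ≡⟨ *-identityʳ _ ⟩
    E + k * (E + c * M)              ≤⟨ +-mono-≤ (m≤m*n E (N * M) {{>-nonZero NM≥1}})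
                                          (*-mono-≤ k≤N (+-monoˡ-≤ (c * M) (m≤m*n E M {{>-nonZero 1≤M}}))) ⟩
    E * (N * M) + N * (E * M + c * M) ≡⟨ solve 4 (λ E N M c →
                                            E :* (N :* M) :+ N :* (E :* M :+ c :* M)
                                            := (E :+ (E :+ c)) :* (N :* M)) refl E N M c ⟩
    (E + (E + c)) * (N * M)          ∎
    where
    open ≤-Reasoning
    open +-*-Solver

update-same : ∀ f i a → (f [ i ↦ a ]) i ≡ a
update-same f i a with i ≡ᵇ i in eq
... | true = refl
... | false = contradiction (≡⇒≡ᵇ i i refl) (subst (λ b → ¬ T b) (sym eq) id)

update-other : ∀ f i a {j} → j ≢ i → (f [ i ↦ a ]) j ≡ f j
update-other f i a {j} j≢i with j ≡ᵇ i in eq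
... | false = refl
... | true = contradiction (≡ᵇ⇒≡ j i (subst T (sym eq) _)) j≢i

-- Mixed radix codes

-- The number with the digits ps in base N, least significant digit first.
encode : ℕ → List ℕ → ℕ
encode N [] = 0
encode N (p ∷ ps) = p + N * encode N ps

encode-< : ∀ {n ps} → All (_≤ n) ps → encode (suc n) ps < suc n ^ length ps
encode-< [] = z<s
encode-< {n} {p ∷ ps} (p≤n ∷ ps≤n) = begin-strict
  p + suc n * encode (suc n) ps         <⟨ +-monoˡ-< (suc n * encode (suc n) ps) (s≤s p≤n) ⟩
  suc n + suc n * encode (suc n) ps     ≡⟨ *-suc (suc n) (encode (suc n) ps) ⟨
  suc n * suc (encode (suc n) ps)       ≤⟨ *-monoʳ-≤ (suc n) (encode-< ps≤n) ⟩
  suc n ^ length (p ∷ ps)               ∎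
  where open ≤-Reasoning

encode-injective : ∀ {n ps qs} → length ps ≡ length qs → All (_≤ n) ps → All (_≤ n) qs →
  encode (suc n) ps ≡ encode (suc n) qs → ps ≡ qs
encode-injective {ps = []} {[]} _ _ _ _ = refl
encode-injective {n} {p ∷ ps} {q ∷ qs} len (p≤n ∷ ps≤n) (q≤n ∷ qs≤n) eq =
  cong₂ _∷_ p≡q (encode-injective (suc-injective len) ps≤n qs≤n
    (*-cancelˡ-≡ _ _ (suc n) (+-cancelˡ-≡ p _ _ (trans eq (cong (_+ suc n * encode (suc n) qs) (sym p≡q))))))
  where
  digit : ∀ {p} ps → p ≤ n → (p + suc n * encode (suc n) ps) % suc n ≡ p
  digit {p} ps p≤n = trans (cong (λ k → (p + k) % suc n) (*-comm (suc n) (encode (suc n) ps)))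
    (trans ([m+kn]%n≡m%n p (encode (suc n) ps) (suc n)) (m<n⇒m%n≡m (s≤s p≤n)))
  p≡q : p ≡ q
  p≡q = trans (sym (digit ps p≤n)) (trans (cong (_% suc n) eq) (digit qs q≤n))

encode-mono : ∀ N {ps qs} → Pointwise _<_ ps qs → encode N ps ≤ encode N qs
encode-mono N [] = z≤n
encode-mono N (p<q ∷ ps<qs) = +-mono-≤ (<⇒≤ p<q) (*-monoʳ-≤ N (encode-mono N ps<qs))

encode-strict : ∀ N {p ps qs} → Pointwise _<_ (p ∷ ps) qs → encode N (p ∷ ps) < encode N qs
encode-strict N (p<q ∷ ps<qs) = +-mono-<-≤ p<q (*-monoʳ-≤ N (encode-mono N ps<qs))

encode-zero : ∀ N k → encode N (replicate k 0) ≡ 0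
encode-zero N zero = refl
encode-zero N (suc k) = trans (cong (N *_) (encode-zero N k)) (*-zeroʳ N)

-- Computing a code

-- The registers used for computing codes: the accumulator, the new accumulator
-- under construction, and the counter of the multiplication loop.
data Temporary : ℕ → Set where
  acc : Temporary 1
  tmp : Temporary 2
  cnt : Temporary 3

-- The states differ in temporary registers only.
Agree : State → State → Set
Agree σ τ = mem τ ≡ mem σ × (∀ {x} → ¬ Temporary x → regs τ x ≡ regs σ x)

agree-refl : ∀ {σ} → Agree σ σ
agree-refl = refl , λ _ → refl

agree-assign : ∀ {σ τ x a} → Temporary x → Agree σ τ → Agree σ ⟪ regs τ [ x ↦ a ] , mem τ ⟫
agree-assign {τ = τ} {x} {a} t (m , f) = m , λ {y} ¬t →
  trans (update-other (regs τ) x a λ { refl → ¬t t }) (f ¬t)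

-- Leaves the code of the values of es, in base n + 1, in register 1, by the rule
-- of Horner; the multiplication by n + 1 is a loop of additions.  Register 0 has
-- to hold n.
loadCode : List Exp → Program
loadCode [] = 1 ≔ lit 0
loadCode (e ∷ es) =
  loadCode es ⨾
  2 ≔ e ⨾
  3 ≔ reg 0 ⊕ lit 1 ⨾
  whileNZ (reg 3) (2 ≔ reg 2 ⊕ reg 1 ⨾ 3 ≔ reg 3 ⊖ lit 1) ⨾
  1 ≔ reg 2

-- For each e: its assignment, the 4 steps that set the counter, 12 for the loop per
-- unit of n + 1, and 2 for the final assignment.
loadCost : List Exp → ℕ
loadCost [] = 2
loadCost (e ∷ es) = loadCost es + (suc (cost e) + (4 + (12 + 2)))

loadCode-runs : ∀ {n σ} es vs → regs σ 0 ≡ n →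
  (∀ {τ} → Agree σ τ → map (λ e → ⟦ e ⟧ τ) es ≡ vs) →
  Runs (suc n ^ 1) (loadCost es) (loadCode es) σ
    (λ τ → Agree σ τ × regs τ 1 ≡ encode (suc n) vs)
loadCode-runs {n} {σ} [] vs eq₀ ev with ev agree-refl
... | refl = assign {x = 1} {e = lit 0} {σ = σ} (s≤s z≤n) ▷ λ { refl → agree-assign acc agree-refl , refl }
loadCode-runs {n} {σ} (e ∷ es) [] eq₀ ev = case ev agree-refl of λ ()
loadCode-runs {n} {σ} (e ∷ es) (v ∷ vs) eq₀ ev =
  loadCode-runs es vs eq₀ (λ ag → ∷-injectiveʳ (ev ag)) >> λ { {σ₁} (ag₁ , acc₁) →
  assign {x = 2} {e = e} {σ = σ₁} 1≤N >> λ { refl →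
  assign {x = 3} {e = reg 0 ⊕ lit 1} 1≤N >> λ { refl →
  loop I ≤-refl 1≤sn body {suc n} ≤-refl
    ( agree-assign cnt (agree-assign tmp ag₁) , acc₁
    , trans (+-comm (regs σ₁ 0) 1) (cong suc (trans (proj₂ ag₁ λ ()) eq₀))
    , cong (_+ suc n * E) (∷-injectiveˡ (ev ag₁)) ) >> λ { {τ} (z , k , ag , _ , eq₃ , eq₂) →
  assign {x = 1} {e = reg 2} {σ = τ} 1≤N ▷ λ { refl →
    agree-assign acc ag ,
    trans (sym (+-identityʳ _)) (trans (cong (λ k → regs τ 2 + k * E) (trans (sym z) eq₃)) eq₂) } } } } }
  where
  1≤sn : 1 ≤ suc n
  1≤sn = s≤s z≤n
  1≤N : 1 ≤ suc n ^ 1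
  1≤N = s≤s z≤n
  E = encode (suc n) vs
  -- With k additions to go, register 2 lacks k times the accumulator.
  I : ℕ → State → Set
  I k τ = Agree σ τ × regs τ 1 ≡ E × regs τ 3 ≡ k × regs τ 2 + k * E ≡ v + suc n * E
  body : ∀ {k τ} → I k τ → regs τ 3 ≢ 0 → ∃[ k′ ] k ≡ suc k′ ×
    Runs 1 8 (2 ≔ reg 2 ⊕ reg 1 ⨾ 3 ≔ reg 3 ⊖ lit 1) τ (I k′)
  body {zero} (_ , _ , eq₃ , _) nz = contradiction eq₃ nz
  body {suc k} {τ} (ag , eq₁ , eq₃ , eq₂) _ = k , refl ,
    (assign {x = 2} {e = reg 2 ⊕ reg 1} {σ = τ} ≤-refl >> λ { refl →
     assign {x = 3} {e = reg 3 ⊖ lit 1} ≤-refl ▷ λ { refl →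
       agree-assign cnt (agree-assign tmp ag) , eq₁ , cong (_∸ 1) eq₃ ,
       trans (cong (λ a → regs τ 2 + a + k * E) eq₁) (trans (+-assoc (regs τ 2) E (k * E)) eq₂) } })

-- The program

-- Register 0 holds the length n of the input.  Registers 1 to 3 are temporary (1
-- also serves as index while letters are searched), 4 and 5 hold table entries,
-- 6 to 5 + r the distinct letters, and those from 6 + r on the positions of the
-- current configuration.  In memory, the input is followed by the table: the
-- entry with code c is at address n + c.

letterReg : ℕ → ℕ
letterReg i = 6 + i

letterRegs : ℕ → List ℕ
letterRegs = applyDownFrom letterReg

-- Non-zero exactly when a and b have equal values.
equals : Exp → Exp → Exp
equals a b = lit 1 ⊖ ((a ⊖ b) ⊕ (b ⊖ a))

-- Non-zero exactly when the letter at the address in register 1 is one of the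
-- letters in the registers xs.
memberOf : List ℕ → Exp
memberOf [] = lit 0
memberOf (x ∷ xs) = equals mem[ reg 1 ] (reg x) ⊕ memberOf xs

-- Puts the first letter of the input that is not in the first i letter registers
-- into the next one.
findLetter : ℕ → Program
findLetter i =
  1 ≔ lit 0 ⨾
  whileNZ (memberOf (letterRegs i)) (1 ≔ reg 1 ⊕ lit 1) ⨾
  letterReg i ≔ mem[ reg 1 ]

findLetters : ℕ → Program
findLetters zero    = skip
findLetters (suc i) = findLetters i ⨾ findLetter i

findLetterCost : ℕ → ℕ
findLetterCost i = 2 + ((suc (cost (memberOf (letterRegs i))) + (suc (cost (memberOf (letterRegs i))) + 4)) + 3)

findLettersCost : ℕ → ℕ
findLettersCost zero    = 1
findLettersCost (suc i) = findLettersCost i + findLetterCost i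

-- The expressions that compute advance and scan, the letters read being held in
-- registers.
advanceE : Exp → Exp → Exp
advanceE p a = p ⊕ (lit 1 ⊖ (((mem[ p ] ⊖ a) ⊕ (a ⊖ mem[ p ])) ⊕ (lit 1 ⊖ (reg 0 ⊖ p))))

scanE : Exp → List ℕ → Exp
scanE = foldl (λ p x → advanceE p (reg x))

-- Non-zero exactly when one of the positions in the registers xs is n.
finishedE : List ℕ → Exp
finishedE [] = lit 0
finishedE (x ∷ xs) = (lit 1 ⊖ (reg 0 ⊖ reg x)) ⊕ finishedE xs

module Algorithm (r : ℕ) where

  -- The arrangements of the letters, given as lists of letter registers.
  arrangements : List (List ℕ)
  arrangements = permutations (letterRegs r)

  -- The number of arrangements and hence of positions; it equals r factorial.
  K : ℕ
  K = length arrangements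

  posReg : ℕ → ℕ
  posReg j = 6 + (r + j)

  posRegs : ℕ → List ℕ
  posRegs = applyDownFrom posReg

  -- The positions after one more block with orientation b.
  stepE : Bool → List Exp
  stepE b = zipWith (λ ρ x → scanE (reg x) (orient ρ b)) arrangements (posRegs K)

  -- Loads the table entry of a successor of the current configuration.
  fetch : Bool → ℕ → Program
  fetch b x = loadCode (stepE b) ⨾ x ≔ mem[ reg 0 ⊕ reg 1 ]

  -- Writes the table entry of the current configuration.  The sum 4 + (5 ∸ 4) of
  -- register contents is the maximum of the two fetched entries.
  visit : Program
  visit =
    fetch true 4 ⨾
    fetch false 5 ⨾
    loadCode (map reg (posRegs K)) ⨾
    ifNZ (finishedE (posRegs K))
      (mem[ reg 0 ⊕ reg 1 ]≔ lit 0)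
      (mem[ reg 0 ⊕ reg 1 ]≔ lit 1 ⊕ (reg 4 ⊕ (reg 5 ⊖ reg 4)))

  -- Runs p with position k equal to n, n - 1, ..., 0 in turn.
  descend : ℕ → Program → Program
  descend k p =
    posReg k ≔ reg 0 ⊕ lit 1 ⨾
    whileNZ (reg (posReg k)) (posReg k ≔ reg (posReg k) ⊖ lit 1 ⨾ p)

  -- Nested loops over the positions in the first k position registers; the positions
  -- with smaller numbers are the more significant digits and change more slowly.
  traverse : ℕ → Program → Program
  traverse zero    p = p
  traverse (suc k) p = traverse k (descend k p)

  program : Program
  program = findLetters r ⨾ traverse K visit ⨾ 0 ≔ mem[ reg 0 ]

  -- The added 5 is the assignment of a fetched entry; 5 and 11 are the two ways of
  -- writing an entry.
  visitCost : ℕ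
  visitCost = (loadCost (stepE true) + 5) + ((loadCost (stepE false) + 5) +
    (loadCost (map reg (posRegs K)) + (suc (cost (finishedE (posRegs K))) + (5 + 11))))

  descendCost : ℕ → ℕ
  descendCost c = 4 + (2 + (2 + (4 + c)))

  traverseCost : ℕ → ℕ → ℕ
  traverseCost zero    c = c
  traverseCost (suc k) c = traverseCost k (descendCost c)

  programCost : ℕ
  programCost = findLettersCost r + (traverseCost K visitCost + 3)

-- Finding the letters

nonzero-equals : ∀ a b σ → ⟦ equals a b ⟧ σ ≢ 0 → ⟦ a ⟧ σ ≡ ⟦ b ⟧ σ
nonzero-equals a b σ nz with ⟦ a ⟧ σ ≟ ⟦ b ⟧ σ
... | yes eq = eq
... | no neq = contradiction (1∸≢0 (neq ∘ ∸+∸≡0⇒≡ (⟦ a ⟧ σ) (⟦ b ⟧ σ))) nz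

memberOf-sound : ∀ xs σ → ⟦ memberOf xs ⟧ σ ≢ 0 → mem σ (regs σ 1) ∈ map (regs σ) xs
memberOf-sound [] σ nz = contradiction refl nz
memberOf-sound (x ∷ xs) σ nz with ⟦ equals mem[ reg 1 ] (reg x) ⟧ σ in eq
... | zero = there (memberOf-sound xs σ nz)
... | suc _ = here (nonzero-equals mem[ reg 1 ] (reg x) σ (subst (_≢ 0) (sym eq) λ ()))

memberOf-complete : ∀ xs σ → ⟦ memberOf xs ⟧ σ ≡ 0 → mem σ (regs σ 1) ∉ map (regs σ) xs
memberOf-complete (x ∷ xs) σ z (here eq) =
  case trans (sym (cong (1 ∸_) (trans (cong (λ a → (a ∸ regs σ x) + (regs σ x ∸ a)) eq) (∸+∸-refl (regs σ x)))))
    (m+n≡0⇒m≡0 (⟦ equals mem[ reg 1 ] (reg x) ⟧ σ) z) of λ ()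
memberOf-complete (x ∷ xs) σ z (there i) =
  memberOf-complete xs σ (m+n≡0⇒n≡0 (⟦ equals mem[ reg 1 ] (reg x) ⟧ σ) z) i

-- As long as the list ds is shorter than the alphabet of u, it misses a letter.
new-letter : ∀ u ds → length ds < distinctLetters u → ∃[ q ] q < length u × cells u q ∉ ds
new-letter u ds lt with All.all? (_∈? ds) u
... | yes u⊆ds = contradiction
  (unique-⊆⇒length≤ (deduplicate-! _≟_ u) (All.lookup u⊆ds ∘ ∈-deduplicate⁻ _≟_ u)) (<⇒≱ lt)
... | no ¬u⊆ds = position u (Allₚ.¬All⇒Any¬ (_∈? ds) u ¬u⊆ds)
  where
  position : ∀ u → Any (_∉ ds) u → ∃[ q ] q < length u × cells u q ∉ ds
  position (x ∷ u) (here x∉) = 0 , z<s , x∉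
  position (x ∷ u) (there i) with position u i
  ... | q , q<n , ∉ = suc q , s≤s q<n , ∉

map-applyDownFrom-cong : ∀ {f g : ℕ → ℕ} h i → (∀ {j} → j < i → f (h j) ≡ g (h j)) →
  map f (applyDownFrom h i) ≡ map g (applyDownFrom h i)
map-applyDownFrom-cong h zero eq = refl
map-applyDownFrom-cong h (suc i) eq =
  cong₂ _∷_ (eq ≤-refl) (map-applyDownFrom-cong h i (eq ∘ m<n⇒m<1+n))

-- The first i letter registers hold distinct letters of u, and the input is
-- still in place.
record Found (u : Sequence) (i : ℕ) (σ : State) : Set where
  field
    len    : regs σ 0 ≡ length u
    store≡ : mem σ ≡ cells u
    uniq   : Unique (map (regs σ) (letterRegs i))
    occur  : All (_∈ u) (map (regs σ) (letterRegs i))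

findLetter-runs : ∀ {u i σ} → i < distinctLetters u → Found u i σ →
  Runs (suc (length u) ^ 1) (findLetterCost i) (findLetter i) σ (Found u (suc i))
findLetter-runs {u} {i} {σ} i<r found =
  assign {x = 1} {e = lit 0} {σ = σ} (s≤s z≤n) >> λ { refl →
  loop I ≤-refl (s≤s z≤n) body (m≤n⇒m≤1+n (<⇒≤ q<n)) (+-identityʳ q , Found.store≡ found , update-other (regs σ) 1 0) >>
  λ { {τ} (z , k , k+q , mem≡ , regs≡) →
  assign {x = letterReg i} {e = mem[ reg 1 ]} {σ = τ} (s≤s z≤n) ▷ λ { refl →
    let
      new = mem τ (regs τ 1)
      olds : map (regs τ) (letterRegs i) ≡ ds
      olds = map-applyDownFrom-cong letterReg i λ {j} _ → regs≡ (λ ())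
      tail≡ : map (regs τ [ letterReg i ↦ new ]) (letterRegs i) ≡ ds
      tail≡ = trans (map-applyDownFrom-cong letterReg i λ {j} j<i →
        update-other (regs τ) (letterReg i) new (<⇒≢ j<i ∘ +-cancelˡ-≡ 6 _ _)) olds
      news : map (regs τ [ letterReg i ↦ new ]) (letterRegs (suc i)) ≡ new ∷ ds
      news = cong₂ _∷_ (update-same (regs τ) (letterReg i) new) tail≡
      new∉ : new ∉ ds
      new∉ = subst (new ∉_) olds (memberOf-complete (letterRegs i) τ z)
      new∈ : new ∈ u
      new∈ = subst (_∈ u) (sym (cong (λ m → m (regs τ 1)) mem≡))
        (cells-∈ u (regs τ 1) (≤-<-trans (subst (regs τ 1 ≤_) k+q (m≤n+m _ k)) q<n))
    in record
      { len = trans (regs≡ λ ()) (Found.len found)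
      ; store≡ = mem≡
      ; uniq = subst Unique (sym news) (All.tabulate (λ x∈ eq → new∉ (subst (_∈ ds) (sym eq) x∈)) ∷ Found.uniq found)
      ; occur = subst (All (_∈ u)) (sym news) (new∈ ∷ Found.occur found)
      } } } }
  where
  ds = map (regs σ) (letterRegs i)
  fresh = new-letter u ds (subst (_< distinctLetters u)
    (sym (trans (length-map (regs σ) (letterRegs i)) (length-applyDownFrom letterReg i))) i<r)
  -- The search is sure to stop at the address q of a new letter, if not before.
  q = proj₁ fresh
  q<n = proj₁ (proj₂ fresh)
  I : ℕ → State → Set
  I k τ = k + regs τ 1 ≡ q × mem τ ≡ cells u × (∀ {x} → x ≢ 1 → regs τ x ≡ regs σ x)
  body : ∀ {k τ} → I k τ → ⟦ memberOf (letterRegs i) ⟧ τ ≢ 0 →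
    ∃[ k′ ] k ≡ suc k′ × Runs 1 4 (1 ≔ reg 1 ⊕ lit 1) τ (I k′)
  body {zero} {τ} (q≡ , mem≡ , regs≡) nz = contradiction
    (subst₂ _∈_ (trans (cong (λ m → m (regs τ 1)) mem≡) (cong (cells u) q≡))
      (map-applyDownFrom-cong letterReg i λ _ → regs≡ λ ())
      (memberOf-sound (letterRegs i) τ nz))
    (proj₂ (proj₂ fresh))
  body {suc k} {τ} (k+q , mem≡ , regs≡) _ = k , refl ,
    (assign {x = 1} {e = reg 1 ⊕ lit 1} {σ = τ} ≤-refl ▷ λ { refl →
      trans (cong (k +_) (+-comm (regs τ 1) 1)) (trans (+-suc k _) k+q) , mem≡ ,
      λ x≢1 → trans (update-other (regs τ) 1 _ x≢1) (regs≡ x≢1) })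

findLetters-runs : ∀ {u} i → i ≤ distinctLetters u →
  Runs (suc (length u) ^ 1) (findLettersCost i) (findLetters i) (input u) (Found u i)
findLetters-runs zero _ = runs ⇓skip (s≤s z≤n)
  (record { len = refl ; store≡ = refl ; uniq = [] ; occur = [] })
findLetters-runs (suc i) i<r = findLetters-runs i (<⇒≤ i<r) >> findLetter-runs i<r

found-alphabet : ∀ {u σ} → Found u (distinctLetters u) σ →
  IsAlphabet u (map (regs σ) (letterRegs (distinctLetters u)))
found-alphabet {u} {σ} found = uniq , covers , All.lookup occur
  where
  open Found found
  ds = map (regs σ) (letterRegs (distinctLetters u))
  covers : ∀ {x} → x ∈ u → x ∈ ds
  covers {x} x∈ with x ∈? ds
  ... | yes x∈ds = x∈ds
  ... | no x∉ds = contradiction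
    (unique-⊆⇒length≤ {xs = x ∷ ds} {ys = deduplicate _≟_ u}
      (All.tabulate (λ y∈ eq → x∉ds (subst (_∈ ds) (sym eq) y∈)) ∷ uniq)
      λ { (here refl) → ∈-deduplicate⁺ _≟_ x∈ ; (there y∈) → ∈-deduplicate⁺ _≟_ (All.lookup occur y∈) })
    (<⇒≱ (s≤s (≤-reflexive (sym (trans (length-map (regs σ) (letterRegs (distinctLetters u)))
      (length-applyDownFrom letterReg (distinctLetters u)))))))

-- Filling the table

-- Here u is the input and δ gives the contents of the letter registers.
module Traversal (r : ℕ) (u : Sequence) (δ : ℕ → ℕ)
  (alphabet : IsAlphabet u (map δ (letterRegs r))) where

  open Algorithm r

  n = length u

  -- The arrangements as lists of letters.
  Π : List (List ℕ)
  Π = map (map δ) arrangements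

  open Configurations u Π

  -- The input and its letters are where the expressions for a step expect them.
  record Ready (σ : State) : Set where
    constructor ready
    field
      len     : regs σ 0 ≡ n
      letters : ∀ {x} → x ∈ letterRegs r → regs σ x ≡ δ x
      text    : ∀ i → i < n → mem σ i ≡ cells u i

  -- In memory m, the table entries with codes at least i are correct.
  Table : ℕ → (ℕ → ℕ) → Set
  Table i m = ∀ {w} → length w ≡ length Π → All (_≤ n) w → i ≤ encode (suc n) w →
    Width w (m (n + encode (suc n) w))

  letter-not-temporary : ∀ {x} → x ∈ letterRegs r → ¬ Temporary x
  letter-not-temporary x∈ t with ∈-applyDownFrom⁻ letterReg x∈
  letter-not-temporary x∈ () | i , i<r , refl

  position-not-letter : ∀ {x} j → x ∈ letterRegs r → x ≢ posReg j
  position-not-letter j x∈ x≡ with ∈-applyDownFrom⁻ letterReg x∈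
  ... | i , i<r , refl = <⇒≢ (≤-trans i<r (m≤m+n r j)) (+-cancelˡ-≡ 6 _ _ x≡)

  agree-positions : ∀ k {σ τ} → Agree σ τ → map (regs τ) (posRegs k) ≡ map (regs σ) (posRegs k)
  agree-positions k (_ , regs≡) = map-applyDownFrom-cong posReg k λ _ → regs≡ λ ()

  agree-ready : ∀ {σ τ} → Agree σ τ → Ready σ → Ready τ
  agree-ready (mem≡ , regs≡) (ready len letters text) = ready
    (trans (regs≡ λ ()) len)
    (λ x∈ → trans (regs≡ (letter-not-temporary x∈)) (letters x∈))
    (λ i i<n → trans (cong (λ m → m i) mem≡) (text i i<n))

  set-ready : ∀ {σ x a} → x ≢ 0 → x ∉ letterRegs r → Ready σ → Ready ⟪ regs σ [ x ↦ a ] , mem σ ⟫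
  set-ready {σ} {x} {a} x≢0 x∉ (ready len letters text) = ready
    (trans (update-other (regs σ) x a (x≢0 ∘ sym)) len)
    (λ {y} y∈ → trans (update-other (regs σ) x a λ { refl → x∉ y∈ }) (letters y∈))
    text

  arrangement-letters : ∀ {ρ x} → ρ ∈ arrangements → x ∈ ρ → x ∈ letterRegs r
  arrangement-letters ρ∈ = ∈-resp-↭ (permutations-sound (letterRegs r) ρ∈)

  -- At the end of u the machine reads the memory cell n, which belongs to the table;
  -- the guard in advance makes its content irrelevant.
  advanceE-value : ∀ {σ} → Ready σ → ∀ p a →
    ⟦ advanceE p a ⟧ σ ≡ advance u (⟦ p ⟧ σ) (⟦ a ⟧ σ)
  advanceE-value {σ} (ready len _ text) p a with n ≤? ⟦ p ⟧ σ
  ... | no n≰p = cong₂ (λ c m → ⟦ p ⟧ σ + (1 ∸ (((c ∸ ⟦ a ⟧ σ) + (⟦ a ⟧ σ ∸ c)) + (1 ∸ (m ∸ ⟦ p ⟧ σ)))))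
    (text (⟦ p ⟧ σ) (≰⇒> n≰p)) len
  ... | yes n≤p = trans (cong (⟦ p ⟧ σ +_) (trans
      (cong (λ g → 1 ∸ (d + (1 ∸ g))) (trans (cong (_∸ ⟦ p ⟧ σ) len) (m≤n⇒m∸n≡0 n≤p)))
      (1∸≢0 (subst (_≢ 0) (+-comm 1 d) λ ()))))
    (trans (+-identityʳ _) (sym (advance-end u (⟦ p ⟧ σ) (⟦ a ⟧ σ) n≤p)))
    where
    d = (mem σ (⟦ p ⟧ σ) ∸ ⟦ a ⟧ σ) + (⟦ a ⟧ σ ∸ mem σ (⟦ p ⟧ σ))

  scanE-value : ∀ {σ} → Ready σ → ∀ ρ → (∀ {x} → x ∈ ρ → x ∈ letterRegs r) → ∀ p →
    ⟦ scanE p ρ ⟧ σ ≡ scan u (⟦ p ⟧ σ) (map δ ρ)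
  scanE-value rd [] _ p = refl
  scanE-value {σ} rd (x ∷ ρ) ρ⊆ p = trans (scanE-value rd ρ (ρ⊆ ∘ there) (advanceE p (reg x)))
    (cong (λ q → scan u q (map δ ρ)) (trans (advanceE-value rd p (reg x))
      (cong (advance u (⟦ p ⟧ σ)) (Ready.letters rd (ρ⊆ (here refl))))))

  stepE-value : ∀ {σ} → Ready σ → ∀ b →
    map (λ e → ⟦ e ⟧ σ) (stepE b) ≡ step b (map (regs σ) (posRegs K))
  stepE-value {σ} rd b = go arrangements (posRegs K) arrangement-letters
    where
    go : ∀ ρs xs → (∀ {ρ x} → ρ ∈ ρs → x ∈ ρ → x ∈ letterRegs r) →
      map (λ e → ⟦ e ⟧ σ) (zipWith (λ ρ x → scanE (reg x) (orient ρ b)) ρs xs)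
      ≡ zipWith (λ π p → scan u p (orient π b)) (map (map δ) ρs) (map (regs σ) xs)
    go [] xs ρs⊆ = refl
    go (ρ ∷ ρs) [] ρs⊆ = refl
    go (ρ ∷ ρs) (x ∷ xs) ρs⊆ = cong₂ _∷_
      (trans (scanE-value rd (orient ρ b) (λ x∈ → ρs⊆ (here refl) (∈-resp-↭ (orient-↭ ρ b) x∈)) (reg x))
        (cong (scan u (regs σ x)) (sym (orient-map δ ρ b))))
      (go ρs xs (ρs⊆ ∘ there))

  nonzero-finishedE : ∀ {σ} → regs σ 0 ≡ n → ∀ xs → ⟦ finishedE xs ⟧ σ ≢ 0 →
    Finished (map (regs σ) xs)
  nonzero-finishedE len [] nz = contradiction refl nz
  nonzero-finishedE {σ} len (x ∷ xs) nz with n ≤? regs σ x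
  ... | yes n≤x = here n≤x
  ... | no n≰x = there (nonzero-finishedE len xs λ z → nz (cong₂ _+_
    (1∸≢0 (m>n⇒m∸n≢0 (subst (regs σ x <_) (sym len) (≰⇒> n≰x)))) z))

  zero-finishedE : ∀ {σ} → regs σ 0 ≡ n → ∀ xs → ⟦ finishedE xs ⟧ σ ≡ 0 →
    ¬ Finished (map (regs σ) xs)
  zero-finishedE {σ} len (x ∷ xs) z (here n≤x) = case trans
    (sym (cong (1 ∸_) (trans (cong (_∸ regs σ x) len) (m≤n⇒m∸n≡0 n≤x))))
    (m+n≡0⇒m≡0 (1 ∸ (regs σ 0 ∸ regs σ x)) z) of λ ()
  zero-finishedE {σ} len (x ∷ xs) z (there fin) =
    zero-finishedE len xs (m+n≡0⇒n≡0 (1 ∸ (regs σ 0 ∸ regs σ x)) z) fin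

  length-positions : ∀ σ → length (map (regs σ) (posRegs K)) ≡ length Π
  length-positions σ = trans (length-map (regs σ) (posRegs K))
    (trans (length-applyDownFrom posReg K) (sym (length-map (map δ) arrangements)))

  -- There is at least one position, so that an increase of all positions shows in the
  -- code.
  0<length-Π : 0 < length Π
  0<length-Π = subst (0 <_) (sym (trans (length-map (map δ) arrangements)
    (length-permutations (letterRegs r)))) (>-nonZero⁻¹ _ {{length (letterRegs r) !≢0}})

  Π-sound : ∀ {π} → π ∈ Π → π ↭ map δ (letterRegs r)
  Π-sound π∈ with ∈-map⁻ (map δ) π∈
  ... | ρ , ρ∈ , refl = ↭-map⁺ δ (permutations-sound (letterRegs r) ρ∈)

  Π-complete : ∀ {π} → π ↭ map δ (letterRegs r) → π ∈ Π
  Π-complete π↭ with ↭-map-inv δ (↭-sym π↭)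
  ... | ρ , refl , ↭ρ = ∈-map⁺ (map δ) (permutations-complete (letterRegs r) (↭-sym ↭ρ))

  step-≤ : ∀ b {v} → All (_≤ n) v → All (_≤ n) (step b v)
  step-≤ b {v} = go Π v
    where
    go : ∀ Π v → All (_≤ n) v → All (_≤ n) (zipWith (λ π p → scan u p (orient π b)) Π v)
    go [] v _ = []
    go (π ∷ Π) [] _ = []
    go (π ∷ Π) (p ∷ v) (p≤n ∷ v≤n) = scan-≤ u p (orient π b) p≤n ∷ go Π v v≤n

  step-increases : ∀ b {v} → length v ≡ length Π → ¬ Finished v → Pointwise _<_ v (step b v)
  step-increases b {v} = go Π v Π-sound
    where
    go : ∀ Π v → (∀ {π} → π ∈ Π → π ↭ map δ (letterRegs r)) → length v ≡ length Π → ¬ Finished v →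
      Pointwise _<_ v (zipWith (λ π p → scan u p (orient π b)) Π v)
    go [] [] _ _ _ = []
    go (π ∷ Π) (p ∷ v) sound len ¬fin =
      scan-progress u p (orient π b) p<n
        (∈-resp-↭ (↭-sym (↭-trans (orient-↭ π b) (sound (here refl))))
          (proj₁ (proj₂ alphabet) (cells-∈ u p p<n)))
      ∷ go Π v (sound ∘ there) (suc-injective len) (¬fin ∘ there)
      where
      p<n : p < n
      p<n = ≰⇒> (¬fin ∘ here)

  step-encode : ∀ b {v} → length v ≡ length Π → ¬ Finished v →
    encode (suc n) v < encode (suc n) (step b v)
  step-encode b {[]} len _ = contradiction len (<⇒≢ 0<length-Π)
  step-encode b {p ∷ v} len ¬fin = encode-strict (suc n) (step-increases b {p ∷ v} len ¬fin)

  -- Writing the entry of v spoils no other entry, as codes determine configurations.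
  Table-extend : ∀ {v a m} → length v ≡ length Π → All (_≤ n) v → Width v a →
    Table (suc (encode (suc n) v)) m →
    Table (encode (suc n) v) (m [ n + encode (suc n) v ↦ a ])
  Table-extend {v} {a} {m} lenv v≤n width table {w} lenw w≤n le
    with encode (suc n) v ≟ encode (suc n) w
  ... | yes eq with encode-injective (trans lenv (sym lenw)) v≤n w≤n eq
  ... | refl = subst (Width w) (sym (update-same m (n + encode (suc n) v) a)) width
  Table-extend {v} {a} {m} lenv v≤n width table {w} lenw w≤n le | no neq =
    subst (Width w) (sym (update-other m (n + encode (suc n) v) a (neq ∘ sym ∘ +-cancelˡ-≡ n _ _)))
      (table lenw w≤n (≤∧≢⇒< le neq))

  -- The memory and the positions are those of σ, and another step can be computed.
  record Kept (σ τ : State) : Set where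
    constructor kept
    field
      isReady   : Ready τ
      positions : map (regs τ) (posRegs K) ≡ map (regs σ) (posRegs K)
      memory    : mem τ ≡ mem σ

  agree-kept : ∀ {σ τ υ} → Agree τ υ → Kept σ τ → Kept σ υ
  agree-kept ag (kept rd pos m) =
    kept (agree-ready ag rd) (trans (agree-positions K ag) pos) (trans (proj₁ ag) m)

  fetch-runs : ∀ {σ τ} b x → 4 ≤ x → x ≤ 5 → Kept σ τ →
    Runs (suc n ^ 1) (loadCost (stepE b) + 5) (fetch b x) τ (λ υ → Kept σ υ ×
      regs υ x ≡ mem σ (n + encode (suc n) (step b (map (regs σ) (posRegs K)))) ×
      (∀ {y} → ¬ Temporary y → y ≢ x → regs υ y ≡ regs τ y))
  fetch-runs {σ} {τ} b x 4≤x x≤5 k@(kept rd _ _) =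
    loadCode-runs (stepE b) w (Ready.len rd) value >> λ { {υ} (ag , acc≡) →
    assign {x = x} {e = mem[ reg 0 ⊕ reg 1 ]} {σ = υ} (s≤s z≤n) ▷ λ { refl →
      let kept rd′ pos′ mem′ = agree-kept ag k
          a = ⟦ mem[ reg 0 ⊕ reg 1 ] ⟧ υ in
      kept (set-ready x≢0 x∉letters rd′)
        (trans (map-applyDownFrom-cong posReg K λ {j} _ →
          update-other (regs υ) x a (>⇒≢ (≤-trans (s≤s x≤5) (m≤m+n 6 (r + j))))) pos′)
        mem′ ,
      trans (update-same (regs υ) x a)
        (trans (cong (mem υ) (cong₂ _+_ (Ready.len rd′) acc≡)) (cong (λ m → m _) mem′)) ,
      λ ¬t y≢x → trans (update-other (regs υ) x a y≢x) (proj₂ ag ¬t) } }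
    where
    w = step b (map (regs σ) (posRegs K))
    value : ∀ {υ} → Agree τ υ → map (λ e → ⟦ e ⟧ υ) (stepE b) ≡ w
    value ag = let kept rd′ pos′ _ = agree-kept ag k in
      trans (stepE-value rd′ b) (cong (step b) pos′)
    x≢0 : x ≢ 0
    x≢0 = >⇒≢ (≤-trans (s≤s z≤n) 4≤x)
    x∉letters : x ∉ letterRegs r
    x∉letters x∈ with ∈-applyDownFrom⁻ letterReg x∈
    ... | i , _ , refl = contradiction x≤5 (<⇒≱ (m≤m+n 6 i))

  visit-runs : ∀ {σ} → Ready σ → All (_≤ n) (map (regs σ) (posRegs K)) →
    Table (suc (encode (suc n) (map (regs σ) (posRegs K)))) (mem σ) →
    Runs (suc n ^ 1) visitCost visit σ (λ τ → Ready τ ×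
      map (regs τ) (posRegs K) ≡ map (regs σ) (posRegs K) ×
      Table (encode (suc n) (map (regs σ) (posRegs K))) (mem τ))
  visit-runs {σ} rd v≤n table =
    fetch-runs true 4 ≤-refl (n≤1+n 4) (kept rd refl refl) >> λ { {σ₁} (k₁ , eq₄ , _) →
    fetch-runs false 5 (n≤1+n 4) ≤-refl k₁ >> λ { {σ₂} (k₂ , eq₅ , regs₂) →
    loadCode-runs (map reg (posRegs K)) v (Ready.len (Kept.isReady k₂))
      (λ ag → trans (sym (map-∘ (posRegs K))) (trans (agree-positions K ag) (Kept.positions k₂)))
      >> λ { {σ₃} (ag₃ , acc≡) →
    let kept rd₃ pos₃ mem₃ = agree-kept ag₃ k₂
        len₃ = Ready.len rd₃
        address : regs σ₃ 0 + regs σ₃ 1 ≡ n + encode (suc n) v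
        address = cong₂ _+_ len₃ acc≡
        reg₄ = trans (proj₂ ag₃ λ ()) (trans (regs₂ (λ ()) λ ()) eq₄)
        reg₅ = trans (proj₂ ag₃ λ ()) eq₅
        done : ∀ {a} → Width v a → Ready ⟪ regs σ₃ , mem σ₃ [ regs σ₃ 0 + regs σ₃ 1 ↦ a ] ⟫ × _ ×
          Table (encode (suc n) v) (mem σ₃ [ regs σ₃ 0 + regs σ₃ 1 ↦ a ])
        done {a} width =
          ready len₃ (Ready.letters rd₃)
            (λ i i<n → trans (update-other (mem σ₃) _ a
              (<⇒≢ (≤-trans i<n (subst (n ≤_) (sym address) (m≤m+n n _))))) (Ready.text rd₃ i i<n)) ,
          pos₃ ,
          subst₂ (λ k m → Table (encode (suc n) v) (m [ k ↦ a ])) (sym address) (sym mem₃)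
            (Table-extend {m = mem σ} (length-positions σ) v≤n width table)
    in branch {e = finishedE (posRegs K)} (s≤s z≤n)
      (λ nz → store {σ = σ₃} (s≤s z≤n) ▷ λ { refl →
        done (finished (subst Finished pos₃ (nonzero-finishedE len₃ (posRegs K) nz))) })
      (λ z → store {σ = σ₃} (s≤s z≤n) ▷ λ { refl →
        let ¬fin = zero-finishedE len₃ (posRegs K) z ∘ subst Finished (sym pos₃) in
        done (subst₂ (λ a b → Width v (suc (a + (b ∸ a)))) (sym reg₄) (sym reg₅)
          (running ¬fin (entry true ¬fin) (entry false ¬fin))) }) } } }
    where
    v = map (regs σ) (posRegs K)
    -- The successors have larger codes, so their entries are already correct.
    entry : ∀ b → ¬ Finished v → Width (step b v) (mem σ (n + encode (suc n) (step b v)))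
    entry b ¬fin = table (length-step b (length-positions σ)) (step-≤ b v≤n)
      (step-encode b (length-positions σ) ¬fin)

  -- The positions in the registers posReg j with j < k are taken as the leading
  -- digits of a code, E being the number that they form.  If the table is correct
  -- from (E + 1) * (n + 1) ^ i on, then p makes it correct from E * (n + 1) ^ i on,
  -- that is, for all codes with these leading digits and i further ones.  It does
  -- so within c * (n + 1) ^ (i + 1) steps.
  Completes : ℕ → ℕ → ℕ → Program → Set
  Completes k i c p = ∀ {σ} → Ready σ → All (_≤ n) (map (regs σ) (posRegs k)) →
    Table (suc (encode (suc n) (map (regs σ) (posRegs k))) * suc n ^ i) (mem σ) →
    Runs (suc n ^ suc i) c p σ (λ τ → Ready τ ×
      map (regs τ) (posRegs k) ≡ map (regs σ) (posRegs k) ×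
      Table (encode (suc n) (map (regs σ) (posRegs k)) * suc n ^ i) (mem τ))

  visit-completes : Completes K 0 visitCost visit
  visit-completes {σ} rd v≤n table =
    visit-runs rd v≤n (λ {w} lw w≤n le → table lw w≤n (≤-trans (≤-reflexive (*-identityʳ _)) le)) ▷
    λ { (rd′ , pos′ , table′) → rd′ , pos′ ,
      λ lw w≤n le → table′ lw w≤n (≤-trans (≤-reflexive (sym (*-identityʳ _))) le) }

  descend-completes : ∀ {k i c p} → Completes (suc k) i c p → Completes k (suc i) (descendCost c) (descend k p)
  descend-completes {k} {i} {c} {p} completes {σ} rd v≤n table =
    assign {x = x} {e = reg 0 ⊕ lit 1} {σ = σ} 1≤M >> λ { refl →
    loop I (m^n>0 (suc n) (suc i)) (s≤s z≤n) body ≤-refl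
      ( ≤-refl
      , trans (update-same (regs σ) x _) (trans (+-comm (regs σ 0) 1) (cong suc (Ready.len rd)))
      , position-ready rd
      , positions-kept (regs σ) _
      , λ lw w≤n le → table lw w≤n (≤-trans (≤-reflexive (sym full-block)) le) ) ▷
    λ { {τ} (z , m , _ , x≡m , rd′ , pos′ , table′) →
      rd′ , pos′ , λ lw w≤n le → table′ lw w≤n
        (≤-trans (≤-reflexive (trans (cong (λ m → (m + N * E) * N ^ i) (trans (sym x≡m) z)) empty-block)) le) } }
    where
    N = suc n
    x = posReg k
    v = map (regs σ) (posRegs k)
    E = encode N v
    1≤M : 1 ≤ N ^ suc (suc i)
    1≤M = m^n>0 N (suc (suc i))
    -- After the runs with this digit equal to n, ..., m, the table is correct for
    -- all codes whose digit is at least m.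
    I : ℕ → State → Set
    I m τ = m ≤ N × regs τ x ≡ m × Ready τ × map (regs τ) (posRegs k) ≡ v ×
      Table ((m + N * E) * N ^ i) (mem τ)
    full-block : (N + N * E) * N ^ i ≡ suc E * N ^ suc i
    full-block = solve 3 (λ N E P → (N :+ N :* E) :* P := (con 1 :+ E) :* (N :* P)) refl N E (N ^ i)
      where open +-*-Solver
    empty-block : (0 + N * E) * N ^ i ≡ E * N ^ suc i
    empty-block = solve 3 (λ N E P → (N :* E) :* P := E :* (N :* P)) refl N E (N ^ i)
      where open +-*-Solver
    position-ready : ∀ {τ a} → Ready τ → Ready ⟪ regs τ [ x ↦ a ] , mem τ ⟫
    position-ready = set-ready (λ ()) λ x∈ → position-not-letter k x∈ refl
    positions-kept : ∀ f a → map (f [ x ↦ a ]) (posRegs k) ≡ map f (posRegs k)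
    positions-kept f a = map-applyDownFrom-cong posReg k λ j<k →
      update-other f x a (<⇒≢ j<k ∘ +-cancelˡ-≡ r _ _ ∘ +-cancelˡ-≡ 6 _ _)
    body : ∀ {m τ} → I m τ → regs τ x ≢ 0 → ∃[ m′ ] m ≡ suc m′ ×
      Runs (N ^ suc i) (4 + c) (x ≔ reg x ⊖ lit 1 ⨾ p) τ (I m′)
    body {zero} (_ , x≡0 , _) nz = contradiction x≡0 nz
    body {suc m} {τ} (m<N , x≡m , rdτ , posτ , tableτ) _ = m , refl ,
      (assign {x = x} {e = reg x ⊖ lit 1} {σ = τ} (m^n>0 N (suc i)) >> λ { refl →
        let τ′ = ⟪ regs τ [ x ↦ regs τ x ∸ 1 ] , mem τ ⟫
            digits : map (regs τ′) (posRegs (suc k)) ≡ m ∷ v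
            digits = cong₂ _∷_ (trans (update-same (regs τ) x _) (cong (_∸ 1) x≡m))
              (trans (positions-kept (regs τ) _) posτ)
            code : encode N (map (regs τ′) (posRegs (suc k))) ≡ m + N * E
            code = cong (encode N) digits
        in completes {τ′} (position-ready rdτ)
             (subst (All (_≤ n)) (sym digits) (s≤s⁻¹ m<N ∷ v≤n))
             (subst (λ e → Table (suc e * N ^ i) (mem τ)) (sym code) tableτ) ▷
           λ { {υ} (rdυ , posυ , tableυ) →
             <⇒≤ m<N , ∷-injectiveˡ (trans posυ digits) , rdυ , ∷-injectiveʳ (trans posυ digits) ,
             subst (λ e → Table (e * N ^ i) (mem υ)) code tableυ } })

  traverse-completes : ∀ k {i c p} → Completes k i c p →
    Completes 0 (k + i) (traverseCost k c) (traverse k p)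
  traverse-completes zero completes = completes
  traverse-completes (suc k) {i} {c} {p} completes =
    subst (λ e → Completes 0 e (traverseCost (suc k) c) (traverse (suc k) p)) (+-suc k i)
      (traverse-completes k {suc i} (descend-completes {k} {i} completes))

  -- With no leading digits given, all codes with K digits are covered.
  whole-table : Completes 0 K (traverseCost K visitCost) (traverse K visit)
  whole-table = subst (λ e → Completes 0 e (traverseCost K visitCost) (traverse K visit))
    (+-identityʳ K) (traverse-completes K {0} visit-completes)

  table-runs : ∀ {σ} → Ready σ →
    Runs (suc n ^ suc K) (traverseCost K visitCost) (traverse K visit) σ
      (λ τ → regs τ 0 ≡ n × Width start (mem τ n))
  table-runs {σ} rd = whole-table rd []
    (λ {w} lw w≤n le → contradiction le (<⇒≱
      (subst (encode (suc n) w <_) (beyond w lw) (encode-< w≤n)))) ▷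
    λ { {τ} (rd′ , _ , table) → Ready.len rd′ ,
      subst (λ a → Width start (mem τ a))
        (trans (cong (n +_) (encode-zero (suc n) (length Π))) (+-identityʳ n))
        (table (length-replicate (length Π)) (Allₚ.replicate⁺ (length Π) z≤n) z≤n) }
    where
    -- No code reaches (n + 1) ^ K, so the table is correct from there on at first.
    beyond : ∀ (w : List ℕ) → length w ≡ length Π → suc n ^ length w ≡ 1 * suc n ^ K
    beyond w lw = trans (cong (suc n ^_) (trans lw (length-map (map δ) arrangements)))
      (sym (*-identityˡ (suc n ^ K)))

-- Correctness and running time

open Algorithm using (K; program; programCost)

program-runs : ∀ r u → distinctLetters u ≡ r →
  Runs (suc (length u) ^ suc (K r)) (programCost r) (program r) (input u)
    (λ τ → IsFormationWidth u (output τ))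
program-runs r u refl =
  raise (^-monoʳ-≤ (suc (length u)) {1} {suc (K r)} (s≤s z≤n)) (findLetters-runs r ≤-refl) >> λ { {σ} found →
  let open Traversal r u (regs σ) (found-alphabet found)
      open Configurations u Π in
  table-runs (ready (Found.len found) (λ _ → refl) (λ i _ → cong (λ m → m i) (Found.store≡ found)))
    >> λ { {τ} (len , width) →
  assign {x = 0} {e = mem[ reg 0 ]} {σ = τ} (m^n>0 (suc (length u)) (suc (K r))) ▷ λ { refl →
  isFormationWidth (found-alphabet found) Π-sound Π-complete
    (subst (λ a → Width start (mem τ a)) (sym len) width) } } }

letters-positive : ∀ u {r} → 1 ≤ r → distinctLetters u ≡ r → 1 ≤ length u
letters-positive [] 1≤r refl = contradiction 1≤r λ ()
letters-positive (_ ∷ _) _ _ = s≤s z≤n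

suc-^-bound : ∀ {n} k → 1 ≤ n → suc n ^ k ≤ 2 ^ k * n ^ k
suc-^-bound zero _ = ≤-refl
suc-^-bound {n} (suc k) 1≤n = ≤-trans
  (*-mono-≤ (≤-trans (+-monoˡ-≤ n 1≤n) (≤-reflexive (cong (n +_) (sym (+-identityʳ n)))))
    (suc-^-bound k 1≤n))
  (≤-reflexive ([m*n]*[o*p]≡[m*o]*[n*p] 2 n (2 ^ k) (n ^ k)))

fw-computable : ∀ r → 1 ≤ r → FwComputableInTime r (r ! + 2)
fw-computable r 1≤r = program r , programCost r * 2 ^ suc (K r) , λ u letters →
  let runs {t} {σ} d b width = program-runs r u letters
  in t , σ , d , width , ≤-trans b (time-bound (letters-positive u 1≤r letters))
  where
  K≡r! : K r ≡ r !
  K≡r! = trans (length-permutations (letterRegs r)) (cong _! (length-applyDownFrom letterReg r))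
  time-bound : ∀ {n} → 1 ≤ n →
    programCost r * suc n ^ suc (K r) ≤ programCost r * 2 ^ suc (K r) * n ^ (r ! + 2)
  time-bound {n} 1≤n = begin
    programCost r * suc n ^ suc (K r)
      ≤⟨ *-monoʳ-≤ (programCost r) (suc-^-bound (suc (K r)) 1≤n) ⟩
    programCost r * (2 ^ suc (K r) * n ^ suc (K r))
      ≡⟨ *-assoc (programCost r) (2 ^ suc (K r)) (n ^ suc (K r)) ⟨
    programCost r * 2 ^ suc (K r) * n ^ suc (K r)
      ≤⟨ *-monoʳ-≤ (programCost r * 2 ^ suc (K r)) (^-monoʳ-≤ n {{>-nonZero 1≤n}} exponent) ⟩
    programCost r * 2 ^ suc (K r) * n ^ (r ! + 2) ∎
    where
    open ≤-Reasoning
    exponent : suc (K r) ≤ r ! + 2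
    exponent = ≤-trans (≤-reflexive (cong suc K≡r!))
      (≤-trans (n≤1+n _) (≤-reflexive (+-comm 2 (r !))))

mainTheorem2 : (∀ (r : ℕ) → 1 ≤ r → FwComputableInTime r (r ! + 2))
    × (Σ[ α ∈ (ℕ → ℕ) ] (∀ (r : ℕ) → 1 ≤ r → FwComputableInTime r (α r)))
mainTheorem2 = fw-computable , (λ r → r ! + 2) , fw-computable
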